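{- Let $n \geq 5$. Then there are no equivelar $(n+1)$-toroids of type $\{4,3^{n-2},4\}$ with $k$ flag-orbits whenever $2<k<n$.
   Context: The cubic tessellation $\mathcal{U}=\{4,3^{n-2},4\}$ of $\mathbb{E}^n$ is the face-to-face tiling by unit $n$-cubes with vertex set $\mathbb{Z}^n$; $G(\mathcal{U})$ denotes its symmetry group. For a rank-$n$ lattice group $\mathbf{L}$ (group generated by $n$ translations with linearly independent vectors) consisting of symmetries of $\mathcal{U}$, the $(n+1)$-toroid $\mathcal{U}/\mathbf{L}$ is the quotient of $\mathcal{U}$ by $\mathbf{L}$ (an equivelar toroid of type $\{4,3^{n-2},4\}$). Its flags are the $\mathbf{L}$-orbits of flags of $\mathcal{U}$ (a flag being a chain of faces of $\mathcal{U}$ containing exactly one face of each dimension $0,\dots,n$), and its automorphism group $N_{G(\mathcal{U})}(\mathbf{L})/\mathbf{L}$ acts on them by $(\Phi\mathbf{L})(\mathbf{L}S)=(\Phi S)\mathbf{L}$; the number of orbits of this action is the number of flag-orbits. -}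

module Defs where

open import Data.Nat using (ℕ; zero; suc)
open import Data.Integer using (ℤ; _+_; _*_; -_; 0ℤ; 1ℤ)
open import Data.Fin using (Fin; zero; suc)
open import Data.Fin.Subset using (Subset; _∈_; _∉_; ∣_∣)
open import Data.Fin.Permutation using (Permutation′; _⟨$⟩ʳ_; _⟨$⟩ˡ_)
open import Data.Vec using (Vec; lookup; tabulate; zipWith)
open import Data.Bool using (Bool; true; false; if_then_else_)
open import Data.Product using (Σ; ∃; _×_; _,_)
open import Data.Sum using (_⊎_)
open import Relation.Binary.PropositionalEquality using (_≡_)

-- Points of ℤⁿ (the vertex set of the cubic tessellation 𝓤 of 𝔼ⁿ).
Point : ℕ → Set
Point n = Vec ℤ n

_⊕_ : ∀ {n} → Point n → Point n → Point n
_⊕_ = zipWith _+_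

sumℤ : ∀ m → (Fin m → ℤ) → ℤ
sumℤ zero    f = 0ℤ
sumℤ (suc m) f = f zero + sumℤ m (λ i → f (suc i))

lincomb : ∀ {n} → (Fin n → ℤ) → (Fin n → Point n) → Point n
lincomb {n} c b = tabulate (λ j → sumℤ n (λ i → c i * lookup (b i) j))

zeroP : ∀ {n} → Point n
zeroP = tabulate (λ _ → 0ℤ)

-- Linear independence of the vectors b₀,…,bₙ₋₁ (for integer vectors,
-- independence over ℤ is equivalent to independence over ℝ).
LinIndep : ∀ {n} → (Fin n → Point n) → Set
LinIndep {n} b = ∀ (c : Fin n → ℤ) → lincomb c b ≡ zeroP → ∀ i → c i ≡ 0ℤ

InLattice : ∀ {n} → (Fin n → Point n) → Point n → Set
InLattice {n} b x = Σ (Fin n → ℤ) (λ c → x ≡ lincomb c b)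

-- Symmetries of 𝓤: x ↦ P x + t with P a signed permutation matrix and
-- t ∈ ℤⁿ; this is G(𝓤) = ℤⁿ ⋊ Bₙ.  (P x)_{π i} = ±x_i.
record Sym (n : ℕ) : Set where
  constructor sym
  field
    perm  : Permutation′ n
    neg   : Fin n → Bool
    trans : Point n

-- Action of a symmetry on points of ℤⁿ (which determines it as an isometry).
act : ∀ {n} → Sym n → Point n → Point n
act (sym π s t) x =
  tabulate (λ j → (if s (π ⟨$⟩ˡ j) then - lookup x (π ⟨$⟩ˡ j) else lookup x (π ⟨$⟩ˡ j))
                  + lookup t j)

-- g normalizes 𝐋 :  g 𝐋 g⁻¹ = 𝐋, i.e. g∘τ_l = τ_{l'}∘g relating translations of 𝐋 both ways.
Normalizes : ∀ {n} → (Fin n → Point n) → Sym n → Set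
Normalizes b g =
  (∀ l → InLattice b l → Σ _ (λ l' → InLattice b l' × (∀ x → act g (x ⊕ l) ≡ act g x ⊕ l')))
  × (∀ l' → InLattice b l' → Σ _ (λ l → InLattice b l × (∀ x → act g (x ⊕ l) ≡ act g x ⊕ l')))

-- Faces of 𝓤: the face (v , S) is the cube v + [0,1]^S (coordinates outside S fixed),
-- of dimension |S|; faces are identified with their vertex sets.
Face : ℕ → Set
Face n = Point n × Subset n

dim : ∀ {n} → Face n → ℕ
dim (v , S) = ∣ S ∣

_∈F_ : ∀ {n} → Point n → Face n → Set
x ∈F (v , S) = ∀ i → (i ∈ S → (lookup x i ≡ lookup v i) ⊎ (lookup x i ≡ lookup v i + 1ℤ))
                     × (i ∉ S → lookup x i ≡ lookup v i)

_⊆F_ : ∀ {n} → Face n → Face n → Set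
F ⊆F G = ∀ x → x ∈F F → x ∈F G

record Flag (n : ℕ) : Set where
  field
    face  : Fin (suc n) → Face n
    dimOk : ∀ j → dim (face j) ≡ Data.Fin.toℕ j
    chain : ∀ (j : Fin n) → face (Data.Fin.inject₁ j) ⊆F face (suc j)

MapsFace : ∀ {n} → Sym n → Face n → Face n → Set
MapsFace g F G = (∀ y → y ∈F F → act g y ∈F G) × (∀ x → x ∈F G → ∃ (λ y → y ∈F F × act g y ≡ x))

MapsFlag : ∀ {n} → Sym n → Flag n → Flag n → Set
MapsFlag g Φ Ψ = ∀ j → MapsFace g (Flag.face Φ j) (Flag.face Ψ j)

-- The flags 𝐋Φ and 𝐋Ψ of 𝓤/𝐋 lie in the same orbit under
-- Aut(𝓤/𝐋) = N_{G(𝓤)}(𝐋)/𝐋.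
SameOrbit : ∀ {n} → (Fin n → Point n) → Flag n → Flag n → Set
SameOrbit b Φ Ψ = Σ (Sym _) (λ g → Normalizes b g × MapsFlag g Φ Ψ)

HasFlagOrbits : ∀ {n} → (Fin n → Point n) → ℕ → Set
HasFlagOrbits {n} b k =
  Σ (Fin k → Flag n) (λ Φ →
      (∀ Ψ → Σ (Fin k) (λ i → SameOrbit b (Φ i) Ψ))
    × (∀ i j → SameOrbit b (Φ i) (Φ j) → i ≡ j))

{-# OPTIONS --safe #-}
module Submission where

-- The group G(𝓤) is simply transitive on flags and its translations normalise 𝐋, so the number of
-- flag-orbits is the index in Bₙ of the stabiliser K of the lattice.  Assume that this index is less than n.
-- Any partition of the n coordinates that K preserves is trivial, because for n ≥ 5 a proper nontrivial
-- partition has at least n images under transpositions.  Write sᵢ for the i-th sign change.  By the pigeonhole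
-- principle some sᵢsⱼ with i ≠ j lies in K; as "sᵢsⱼ ∈ K" is an equivalence relation preserved by K, every even
-- sign change lies in K.  Among the transpositions (a i) two lie in the same coset, so K contains a
-- transposition or a 3-cycle; for a lattice invariant under even sign changes, invariance under a 3-cycle
-- forces invariance under a transposition.  As "(i j) ∈ K" is again an equivalence relation preserved
-- by K, all permutations lie in K, and hence the index is at most 2.

open import Defs hiding (sym)
open import Data.Nat as ℕ using (ℕ; zero; suc; _≤_; _<_; z≤n; s≤s)
import Data.Nat.Properties as ℕ
open import Data.Nat.GCD using (module Bézout; module GCD)
open import Data.Nat.Divisibility using (divides)
open import Data.Integer using (ℤ; +_; -[1+_]; _+_; _*_; -_; _-_; 0ℤ; 1ℤ; -1ℤ; ∣_∣)
import Data.Integer.Properties as ℤ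
open import Data.Integer.Tactic.RingSolver using (solve-∀)
open import Data.Bool using (Bool; true; false; if_then_else_; _xor_)
import Data.Bool.Properties as Bool
open import Data.Fin as Fin using (Fin; zero; suc; toℕ; fromℕ; inject₁; punchOut)
open import Data.Fin.Patterns using (0F; 1F; 2F; 3F)
open import Data.Fin.Properties using (_≟_; any?)
import Data.Fin.Properties as Fin
open import Data.Fin.Induction using (<-weakInduction; <-weakInduction-startingFrom)
open import Data.Fin.Subset as Subset using (Subset; _∈_; _∉_)
open import Data.Fin.Subset.Properties using (_∈?_; ∈⊤; p⊂q⇒∣p∣<∣q∣; x∈p⇒∣p-x∣<∣p∣; ∣p∣≡n⇒p≡⊤; x∈p∧x≢y⇒x∈p-y)
open import Data.Fin.Permutation as Perm using (Permutation′; permutation; _⟨$⟩ʳ_; _⟨$⟩ˡ_; inverseˡ; inverseʳ; _∘ₚ_)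
open import Data.Fin.Permutation.Components using (transpose)
import Data.Fin.Permutation.Transposition.List as TL
open import Data.List using ([]; _∷_)
open import Data.Vec using (lookup; tabulate)
open import Data.Vec.Properties using (lookup∘tabulate; lookup-zipWith; tabulate∘lookup; tabulate-cong; []=⇒lookup; lookup⇒[]=)
open import Algebra.Properties.AbelianGroup ℤ.+-0-abelianGroup using (∙-cancelˡ; identityʳ-unique)
open import Algebra.Properties.CommutativeMonoid.Sum ℕ.+-0-commutativeMonoid using (sum; sum-permute; sum-replicate-zero)
open import Data.Product using (Σ; ∃; ∃₂; _×_; _,_; proj₁; proj₂)
open import Data.Sum as Sum using (_⊎_; inj₁; inj₂)
open import Data.Empty using (⊥; ⊥-elim)
open import Function using (_∘_; mk⇔; module Equivalence)
open import Relation.Nullary using (¬_; Dec; yes; no; does; contradiction)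
open import Relation.Nullary.Decidable using (dec-true; dec-false; ¬?; _×-dec_; does-⇔)
open import Relation.Binary using (IsEquivalence; Decidable)
open import Relation.Binary.PropositionalEquality using (_≡_; _≢_; _≗_; refl; sym; trans; cong; cong₂; subst; subst₂; module ≡-Reasoning)

-- Transpositions and partitions

-- The obstacle is that group theory alone stops at the alternating group: a 3-cycle and its
-- conjugates generate only even permutations. The lattice has to supply an odd one, which is why
-- the even sign changes are settled first. On vectors supported on three coordinates, an even sign
-- change that also hits a fourth coordinate acts as a single sign change. The bound 5 comes from
-- the partitions: four points split into two pairs in only three ways, too few for the count when n
-- = 4. K and its cosets are never formed. A signed permutation stands for a flag at the origin, and
-- two of them are in the same coset when they pull the lattice back to the same set of vectors. The
-- given list of orbits makes this relation decidable and open to the pigeonhole principle.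

transpose-first : ∀ {n} (i j : Fin n) → transpose i j i ≡ j
transpose-first i j rewrite dec-true (i ≟ i) refl = refl

transpose-second : ∀ {n} (i j : Fin n) → transpose i j j ≡ i
transpose-second i j with j ≟ i
... | yes j≡i = j≡i
... | no  _ rewrite dec-true (j ≟ j) refl = refl

transpose-other : ∀ {n} {i j k : Fin n} → k ≢ i → k ≢ j → transpose i j k ≡ k
transpose-other {i = i} {j} {k} k≢i k≢j
  rewrite dec-false (k ≟ i) k≢i | dec-false (k ≟ j) k≢j = refl

transpose-self : ∀ {n} (i k : Fin n) → transpose i i k ≡ k
transpose-self i k with k ≟ i
... | yes k≡i = sym k≡i
... | no  k≢i rewrite dec-false (k ≟ i) k≢i = refl

transpose-involutive : ∀ {n} (i j k : Fin n) → transpose i j (transpose i j k) ≡ k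
transpose-involutive i j k = go (k ≟ i) (k ≟ j)
  where
  go : Dec (k ≡ i) → Dec (k ≡ j) → transpose i j (transpose i j k) ≡ k
  go (yes refl) _ = trans (cong (transpose i j) (transpose-first i j)) (transpose-second i j)
  go (no _) (yes refl) = trans (cong (transpose i j) (transpose-second i j)) (transpose-first i j)
  go (no k≢i) (no k≢j) = trans (cong (transpose i j) (transpose-other k≢i k≢j)) (transpose-other k≢i k≢j)

transpose-injective : ∀ {n} (i j : Fin n) {k l} → transpose i j k ≡ transpose i j l → k ≡ l
transpose-injective i j e = trans (sym (transpose-involutive i j _)) (trans (cong (transpose i j) e) (transpose-involutive i j _))

transpose-comm : ∀ {n} (i j k : Fin n) → transpose i j k ≡ transpose j i k
transpose-comm i j k = go (k ≟ i) (k ≟ j)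
  where
  go : Dec (k ≡ i) → Dec (k ≡ j) → transpose i j k ≡ transpose j i k
  go (yes refl) _ = trans (transpose-first i j) (sym (transpose-second j i))
  go (no _) (yes refl) = trans (transpose-second i j) (sym (transpose-first j i))
  go (no k≢i) (no k≢j) = trans (transpose-other k≢i k≢j) (sym (transpose-other k≢j k≢i))

transpose-conj : ∀ {n} (f : Fin n → Fin n) → (∀ {k l} → f k ≡ f l → k ≡ l) →
  ∀ i j k → transpose (f i) (f j) (f k) ≡ f (transpose i j k)
transpose-conj f inj i j k = go (k ≟ i) (k ≟ j)
  where
  go : Dec (k ≡ i) → Dec (k ≡ j) → transpose (f i) (f j) (f k) ≡ f (transpose i j k)
  go (yes refl) _ = trans (transpose-first (f i) (f j)) (cong f (sym (transpose-first i j)))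
  go (no _) (yes refl) = trans (transpose-second (f i) (f j)) (cong f (sym (transpose-second i j)))
  go (no k≢i) (no k≢j) = trans (transpose-other (k≢i ∘ inj) (k≢j ∘ inj)) (cong f (sym (transpose-other k≢i k≢j)))

-- If the four points exhausted `Fin n`, `decode` would be a left inverse of `code`, which would
-- embed at least five points in `Fin 4`.
∃-avoiding₄ : ∀ {n} → 5 ℕ.≤ n → (a b c d : Fin n) → ∃ λ z → z ≢ a × z ≢ b × z ≢ c × z ≢ d
∃-avoiding₄ {n} 5≤n a b c d
  with any? (λ z → ¬? (z ≟ a) ×-dec ¬? (z ≟ b) ×-dec ¬? (z ≟ c) ×-dec ¬? (z ≟ d))
... | yes p = p
... | no ¬p = contradiction collision ¬collision
  where
  code : Fin n → Fin 4
  code z with z ≟ a | z ≟ b | z ≟ c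
  ... | yes _ | _     | _     = 0F
  ... | no _  | yes _ | _     = 1F
  ... | no _  | no _  | yes _ = 2F
  ... | no _  | no _  | no _  = 3F
  decode : Fin 4 → Fin n
  decode 0F = a
  decode 1F = b
  decode 2F = c
  decode 3F = d
  decode-code : ∀ z → decode (code z) ≡ z
  decode-code z with z ≟ a | z ≟ b | z ≟ c
  ... | yes p | _     | _     = sym p
  ... | no _  | yes p | _     = sym p
  ... | no _  | no _  | yes p = sym p
  ... | no p  | no q  | no r with z ≟ d
  ...   | yes s = sym s
  ...   | no  s = contradiction (z , p , q , r , s) ¬p
  collision : ∃₂ λ i j → i Fin.< j × code i ≡ code j
  collision = Fin.pigeonhole 5≤n code
  ¬collision : ¬ (∃₂ λ i j → i Fin.< j × code i ≡ code j)
  ¬collision (i , j , i<j , e) =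
    Fin.<⇒≢ i<j (trans (sym (decode-code i)) (trans (cong decode e) (decode-code j)))

module _ {n} (R : Fin n → Fin n → Set) where

  -- This is the image of `R` under the transposition, which is its own inverse. The pair `(i , i)`
  -- encodes the identity, so `R` itself counts as an image.
  moved : Fin n × Fin n → Fin n → Fin n → Set
  moved (i , j) p q = R (transpose i j p) (transpose i j q)

  -- Holds when R is invariant under a subgroup of Sₙ of index less than n, since two of
  -- any n transpositions then lie in the same coset.
  FewImages : Set
  FewImages = (t : Fin n → Fin n × Fin n) →
    ∃₂ λ z z′ → z ≢ z′ × (∀ p q → moved (t z) p q → moved (t z′) p q)
                       × (∀ p q → moved (t z′) p q → moved (t z) p q)

module NoProperPartition {n} (5≤n : 5 ℕ.≤ n) (R : Fin n → Fin n → Set) (R? : Decidable R)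
  (isEquiv : IsEquivalence R) (few : FewImages R) where

  open IsEquivalence isEquiv renaming (refl to R-refl; sym to R-sym; trans to R-trans)

  Separated : Fin n × Fin n → Fin n × Fin n → Set
  Separated s t = ∃₂ λ p q → (moved R s p q × ¬ moved R t p q) ⊎ (moved R t p q × ¬ moved R s p q)

  separated-sym : ∀ {s t} → Separated s t → Separated t s
  separated-sym (p , q , inj₁ x) = p , q , inj₂ x
  separated-sym (p , q , inj₂ x) = p , q , inj₁ x

  ¬all-separated : (t : Fin n → Fin n × Fin n) → ¬ (∀ z z′ → z ≢ z′ → Separated (t z) (t z′))
  ¬all-separated t sep with few t
  ... | z , z′ , z≢z′ , to , from with sep z z′ z≢z′
  ...   | p , q , inj₁ (x , y) = y (to p q x)
  ...   | p , q , inj₂ (x , y) = y (from p q x)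

  split : ∀ {x y z} → R x y → ¬ R x z → y ≢ z
  split xy ¬xz refl = ¬xz xy

  stays : ∀ {i j p q} → p ≢ i → p ≢ j → q ≢ i → q ≢ j → R p q → moved R (i , j) p q
  stays a b c d r = subst₂ R (sym (transpose-other a b)) (sym (transpose-other c d)) r

  becomes : ∀ {i j p} → p ≢ i → p ≢ j → R p i → moved R (i , j) p j
  becomes {i} {j} a b r = subst₂ R (sym (transpose-other a b)) (sym (transpose-second i j)) r

  ¬stays : ∀ {i j p q} → p ≢ i → p ≢ j → q ≢ i → q ≢ j → ¬ R p q → ¬ moved R (i , j) p q
  ¬stays a b c d ¬r r = ¬r (subst₂ R (transpose-other a b) (transpose-other c d) r)

  leaves : ∀ {i j p} → p ≢ i → p ≢ j → ¬ R p j → ¬ moved R (i , j) p i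
  leaves {i} {j} a b ¬r r = ¬r (subst₂ R (transpose-other a b) (transpose-first i j) r)

  fixed : ∀ {i p q} → R p q → moved R (i , i) p q
  fixed {i} {p} {q} r = subst₂ R (sym (transpose-self i p)) (sym (transpose-self i q)) r

  out-out : ∀ {a b z z′} → a ≢ b → R a b → z ≢ z′ → ¬ R a z → ¬ R a z′ → Separated (a , z) (a , z′)
  out-out {b = b} {z} a≢b ab z≢z′ ¬az ¬az′ = b , z , inj₁
    ( becomes (a≢b ∘ sym) (split ab ¬az) (R-sym ab)
    , ¬stays (a≢b ∘ sym) (split ab ¬az′) (λ { refl → ¬az R-refl }) z≢z′ (λ bz → ¬az (R-trans ab bz)))

  out-id : ∀ {a b z} → a ≢ b → R a b → ¬ R a z → Separated (a , z) (a , a)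
  out-id {a} {b} a≢b ab ¬az = b , a , inj₂
    (fixed (R-sym ab) , leaves (a≢b ∘ sym) (split ab ¬az) (λ bz → ¬az (R-trans ab bz)))

  -- The classes C, C ∖ {a} ∪ {z} (z ∉ C) and C ∖ {z} ∪ {c} (a ≠ z ∈ C) are n distinct images of the class C of a.
  large-class : ∀ {a b d c} → a ≢ b → a ≢ d → b ≢ d → R a b → R a d → ¬ R a c → ⊥
  large-class {a} {b} {d} {c} a≢b a≢d b≢d ab ad ¬ac = ¬all-separated t sep
    where
    pick : (z : Fin n) → Dec (R a z) → Dec (z ≡ a) → Fin n × Fin n
    pick z (no _)  _       = a , z
    pick z (yes _) (no _)  = z , c
    pick z (yes _) (yes _) = a , a
    t : Fin n → Fin n × Fin n
    t z = pick z (R? a z) (z ≟ a)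
    -- Three elements matter here: if the class were just `a` and `z′`, then (a z) and (z′ c) would
    -- have the same image whenever `c` and `z` form a class.
    third : ∀ z → ∃ λ w → R a w × w ≢ a × w ≢ z
    third z with b ≟ z
    ... | yes refl = d , ad , a≢d ∘ sym , b≢d ∘ sym
    ... | no b≢z = b , ab , a≢b ∘ sym , b≢z
    a≢c : a ≢ c
    a≢c refl = ¬ac R-refl
    out-in : ∀ {z z′} → ¬ R a z → z′ ≢ a → R a z′ → Separated (a , z) (z′ , c)
    out-in {z} {z′} ¬az z′≢a az′ with third z′
    ... | w , aw , w≢a , w≢z′ = w , a , inj₂
      ( stays w≢z′ (split aw ¬ac) (z′≢a ∘ sym) a≢c (R-sym aw)
      , leaves w≢a (split aw ¬az) (λ wz → ¬az (R-trans aw wz)))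
    in-in : ∀ {z z′} → z ≢ z′ → z ≢ a → z′ ≢ a → R a z → R a z′ → Separated (z , c) (z′ , c)
    in-in {z′ = z′} z≢z′ z≢a z′≢a az az′ = a , z′ , inj₁
      ( stays (z≢a ∘ sym) a≢c (z≢z′ ∘ sym) (split az′ ¬ac) az′
      , leaves (z′≢a ∘ sym) a≢c ¬ac)
    in-id : ∀ {z} → z ≢ a → R a z → Separated (z , c) (a , a)
    in-id {z} z≢a az = a , z , inj₂ (fixed az , leaves (z≢a ∘ sym) a≢c ¬ac)
    sep : ∀ z z′ → z ≢ z′ → Separated (t z) (t z′)
    sep z z′ z≢z′ with R? a z | z ≟ a | R? a z′ | z′ ≟ a
    ... | no ¬p | _     | no ¬q | _     = out-out a≢b ab z≢z′ ¬p ¬q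
    ... | no ¬p | _     | yes q | no e  = out-in ¬p e q
    ... | no ¬p | _     | yes q | yes e = out-id a≢b ab ¬p
    ... | yes p | no e  | no ¬q | _     = separated-sym (out-in ¬q e p)
    ... | yes p | no e  | yes q | no f  = in-in z≢z′ e f p q
    ... | yes p | no e  | yes q | yes f = in-id e p
    ... | yes p | yes e | no ¬q | _     = separated-sym (out-id a≢b ab ¬q)
    ... | yes p | yes e | yes q | no f  = separated-sym (in-id f q)
    ... | yes p | yes e | yes q | yes f = contradiction (trans e (sym f)) z≢z′

  -- When C = {a , b}, the classes C and {b , z} (z ∉ C) are only n − 1 images; s supplies another.
  small-class : ∀ {a b} → a ≢ b → R a b → (∀ {d} → R a d → d ≢ a → d ≡ b) →
    (s : Fin n × Fin n) → Separated s (a , a) → (∀ {z} → ¬ R a z → Separated s (a , z)) → ⊥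
  small-class {a} {b} a≢b ab only s s-id s-out = ¬all-separated t sep
    where
    pick : (z : Fin n) → Dec (R a z) → Dec (z ≡ a) → Fin n × Fin n
    pick z (no _)  _       = a , z
    pick z (yes _) (no _)  = s
    pick z (yes _) (yes _) = a , a
    t : Fin n → Fin n × Fin n
    t z = pick z (R? a z) (z ≟ a)
    sep : ∀ z z′ → z ≢ z′ → Separated (t z) (t z′)
    sep z z′ z≢z′ with R? a z | z ≟ a | R? a z′ | z′ ≟ a
    ... | no ¬p | _     | no ¬q | _     = out-out a≢b ab z≢z′ ¬p ¬q
    ... | no ¬p | _     | yes q | no e  = separated-sym (s-out ¬p)
    ... | no ¬p | _     | yes q | yes e = out-id a≢b ab ¬p
    ... | yes p | no e  | no ¬q | _     = s-out ¬q
    ... | yes p | no e  | yes q | no f  = contradiction (trans (only p e) (sym (only q f))) z≢z′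
    ... | yes p | no e  | yes q | yes f = s-id
    ... | yes p | yes e | no ¬q | _     = separated-sym (out-id a≢b ab ¬q)
    ... | yes p | yes e | yes q | no f  = separated-sym s-id
    ... | yes p | yes e | yes q | yes f = contradiction (trans e (sym f)) z≢z′

  -- The extra image for `small-class` has two sources. If `c` is alone in its class, (b c) relates
  -- `a` to `c`, which no (a z) with `z` outside the class of `a` does. If `c` has a partner `y`, a
  -- fifth point `w` gives (c w), which keeps `a` and `b` together but separates `c` from `y`,
  -- unless `w` is related to `c` and `large-class` applies to the class of `c`.
  no-proper-class : ∀ {a b c} → a ≢ b → R a b → ¬ R a c → ⊥
  no-proper-class {a} {b} {c} a≢b ab ¬ac
    with any? (λ d → R? a d ×-dec ¬? (a ≟ d) ×-dec ¬? (b ≟ d))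
  ... | yes (d , ad , a≢d , b≢d) = large-class a≢b a≢d b≢d ab ad ¬ac
  ... | no ¬third with any? (λ y → R? c y ×-dec ¬? (c ≟ y))
  ...   | no ¬partner = small-class a≢b ab only (b , c) s-id s-out
    where
    only : ∀ {d} → R a d → d ≢ a → d ≡ b
    only {d} ad d≢a with b ≟ d
    ... | yes b≡d = sym b≡d
    ... | no  b≢d = contradiction (d , ad , d≢a ∘ sym , b≢d) ¬third
    a≢c : a ≢ c
    a≢c refl = ¬ac R-refl
    s-id : Separated (b , c) (a , a)
    s-id = a , b , inj₂ (fixed ab , leaves a≢b a≢c ¬ac)
    s-out : ∀ {z} → ¬ R a z → Separated (b , c) (a , z)
    s-out {z} ¬az with z ≟ c
    ... | yes refl = a , c , inj₁
      ( becomes a≢b a≢c ab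
      , λ r → ¬ac (R-sym (subst₂ R (transpose-first a c) (transpose-second a c) r)))
    ... | no z≢c = a , c , inj₁
      ( becomes a≢b a≢c ab
      , λ r → ¬partner (z , R-sym (subst₂ R (transpose-first a z) (transpose-other (a≢c ∘ sym) (z≢c ∘ sym)) r)
                          , z≢c ∘ sym))
  ...   | yes (y , cy , c≢y) with ∃-avoiding₄ 5≤n a b c y
  ...     | w , w≢a , w≢b , w≢c , w≢y with R? c w
  ...       | yes cw = large-class c≢y (w≢c ∘ sym) (w≢y ∘ sym) cy cw (¬ac ∘ R-sym)
  ...       | no ¬cw = small-class a≢b ab only (c , w) s-id s-out
    where
    only : ∀ {d} → R a d → d ≢ a → d ≡ b
    only {d} ad d≢a with b ≟ d
    ... | yes b≡d = sym b≡d
    ... | no  b≢d = contradiction (d , ad , d≢a ∘ sym , b≢d) ¬third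
    s-id : Separated (c , w) (a , a)
    s-id = y , c , inj₂ (fixed (R-sym cy) , leaves (c≢y ∘ sym) (w≢y ∘ sym) (λ yw → ¬cw (R-trans cy yw)))
    s-out : ∀ {z} → ¬ R a z → Separated (c , w) (a , z)
    s-out ¬az = b , a , inj₁
      ( stays (split ab ¬ac) (w≢b ∘ sym) (λ { refl → ¬ac R-refl }) (w≢a ∘ sym) (R-sym ab)
      , leaves (a≢b ∘ sym) (split ab ¬az) (λ bz → ¬az (R-trans ab bz)))

  total : ∀ {a b} → a ≢ b → R a b → ∀ x y → R x y
  total {a} {b} a≢b ab x y = R-trans (R-sym (reach x)) (reach y)
    where
    reach : ∀ z → R a z
    reach z with R? a z
    ... | yes az = az
    ... | no ¬az = ⊥-elim (no-proper-class a≢b ab ¬az)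

-- Three-cycles and sign changes acting on lattices

2ℤ : ℤ
2ℤ = + 2

half : (z : ℤ) → ∃ λ t → (z ≡ 2ℤ * t) ⊎ (z ≡ 2ℤ * t + 1ℤ)
half (+ zero) = 0ℤ , inj₁ refl
half (+ suc m) with half (+ m)
... | t , inj₁ e = t , inj₂ (trans (ℤ.+-comm 1ℤ (+ m)) (cong (_+ 1ℤ) e))
... | t , inj₂ e = t + 1ℤ , inj₁ (trans (cong (λ □ → 1ℤ + □) e) (lem t))
  where
  lem : ∀ t → 1ℤ + (2ℤ * t + 1ℤ) ≡ 2ℤ * (t + 1ℤ)
  lem = solve-∀
half -[1+ zero ] = -1ℤ , inj₂ refl
half -[1+ suc m ] with half -[1+ m ]
... | t , inj₁ e = t - 1ℤ , inj₂ (trans (cong (λ □ → -1ℤ + □) e) (lem t))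
  where
  lem : ∀ t → -1ℤ + 2ℤ * t ≡ 2ℤ * (t - 1ℤ) + 1ℤ
  lem = solve-∀
... | t , inj₂ e = t , inj₁ (trans (cong (λ □ → -1ℤ + □) e) (lem t))
  where
  lem : ∀ t → -1ℤ + (2ℤ * t + 1ℤ) ≡ 2ℤ * t
  lem = solve-∀

abs-unit : (p : ℤ) → ∃ λ ε → (+ ∣ p ∣ ≡ ε * p) × (p ≡ ε * + ∣ p ∣)
abs-unit (+ m)    = 1ℤ , sym (ℤ.*-identityˡ _) , sym (ℤ.*-identityˡ _)
abs-unit -[1+ m ] = -1ℤ , sym (ℤ.-1*i≡-i -[1+ m ]) , sym (ℤ.-1*i≡-i (+ suc m))

bézout-identity : ∀ {d m n} → Bézout.Identity d m n → ∃₂ λ α β → + d ≡ α * + m + β * + n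
bézout-identity {d} {m} {n} (Bézout.+- x y eq) = + x , - (+ y) , (begin
  + d                                     ≡⟨ lem (+ d) (+ y * + n) ⟩
  (+ d + + y * + n) + - (+ y * + n)       ≡⟨ cong (_+ - (+ y * + n)) eqℤ ⟩
  + x * + m + - (+ y * + n)               ≡⟨ cong (λ □ → + x * + m + □) (ℤ.neg-distribˡ-* (+ y) (+ n)) ⟩
  + x * + m + - (+ y) * + n               ∎)
  where
  open ≡-Reasoning
  lem : ∀ a b → a ≡ (a + b) + - b
  lem = solve-∀
  eqℤ : + d + + y * + n ≡ + x * + m
  eqℤ = trans (cong (λ □ → + d + □) (sym (ℤ.pos-* y n))) (trans (cong +_ eq) (ℤ.pos-* x m))
bézout-identity {d} {m} {n} (Bézout.-+ x y eq) with bézout-identity (Bézout.+- {d} {n} {m} y x eq)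
... | α , β , e = β , α , trans e (ℤ.+-comm (α * + n) (β * + m))

bézout : (p q : ℤ) → ∃ λ d → (∃₂ λ α β → d ≡ α * p + β * q) × (∃ λ p′ → p ≡ p′ * d) × (∃ λ q′ → q ≡ q′ * d)
bézout p q with Bézout.lemma ∣ p ∣ ∣ q ∣ | abs-unit p | abs-unit q
... | Bézout.result d g i | ε , ap , pa | η , aq , qa
  with bézout-identity i | proj₁ (GCD.commonDivisor g) | proj₂ (GCD.commonDivisor g)
...   | α , β , e | divides m em | divides n en =
  + d
  , (α * ε , β * η , trans e (cong₂ _+_ (trans (cong (α *_) ap) (sym (ℤ.*-assoc α ε p)))
                                        (trans (cong (β *_) aq) (sym (ℤ.*-assoc β η q)))))
  , (ε * + m , trans pa (trans (cong (λ □ → ε * □) (trans (cong +_ em) (ℤ.pos-* m d))) (sym (ℤ.*-assoc ε (+ m) (+ d)))))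
  , (η * + n , trans qa (trans (cong (λ □ → η * □) (trans (cong +_ en) (ℤ.pos-* n d))) (sym (ℤ.*-assoc η (+ n) (+ d)))))

-- `M u v w` will say that the vector with these entries at three chosen coordinates, and zero
-- elsewhere, lies in the lattice. There `rot` comes from a 3-cycle and `flip` from an even sign
-- change.
module TripleModule (M : ℤ → ℤ → ℤ → Set)
  (plus  : ∀ {u v w u′ v′ w′} → M u v w → M u′ v′ w′ → M (u + u′) (v + v′) (w + w′))
  (scale : ∀ m {u v w} → M u v w → M (m * u) (m * v) (m * w))
  (rot   : ∀ {u v w} → M u v w → M w u v)
  (flip  : ∀ {u v w} → M u v w → M u v (- w)) where

  cast : ∀ {u v w u′ v′ w′} → u ≡ u′ → v ≡ v′ → w ≡ w′ → M u v w → M u′ v′ w′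
  cast refl refl refl m = m

  double : ∀ {u v w} → M u v w → M 0ℤ 0ℤ (2ℤ * w)
  double {u} {v} {w} m = cast (zero′ u) (zero′ v) (twice w) (plus m (scale -1ℤ (flip m)))
    where
    zero′ : ∀ u → u + -1ℤ * u ≡ 0ℤ
    zero′ = solve-∀
    twice : ∀ w → w + -1ℤ * - w ≡ 2ℤ * w
    twice = solve-∀

  -- Writing d = gcd p q, all of 2dℤ³ lies in M, so only the parities of p / d and q / d matter.
  antidiagonal : ∀ {p q} → M p q (- (p + q)) → M (- q) q 0ℤ
  antidiagonal {p} {q} m with bézout p q
  ... | d , (α , β , ed) , (p′ , ep) , (q′ , eq) = by-parity (half p′) (half q′)
    where
    -- Doubling rotations of the triple puts twice `p` and twice `q` in the last place; the Bézout
    -- coefficients combine them into twice `d`.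
    2d : M 0ℤ 0ℤ (2ℤ * d)
    2d = cast (z α β) (z α β) (trans (lin α β p q) (cong (2ℤ *_) (sym ed)))
           (plus (scale α (double (rot (rot m)))) (scale β (double (rot m))))
      where
      z : ∀ α β → α * 0ℤ + β * 0ℤ ≡ 0ℤ
      z = solve-∀
      lin : ∀ α β p q → α * (2ℤ * p) + β * (2ℤ * q) ≡ 2ℤ * (α * p + β * q)
      lin = solve-∀

    even : ∀ s t u → M (2ℤ * s * d) (2ℤ * t * d) (2ℤ * u * d)
    even s t u = cast (l₁ s t u d) (l₂ s t u d) (l₃ s t u d)
                   (plus (scale s (rot 2d)) (plus (scale t (rot (rot 2d))) (scale u 2d)))
      where
      l₁ : ∀ s t u d → s * (2ℤ * d) + (t * 0ℤ + u * 0ℤ) ≡ 2ℤ * s * d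
      l₁ = solve-∀
      l₂ : ∀ s t u d → s * 0ℤ + (t * (2ℤ * d) + u * 0ℤ) ≡ 2ℤ * t * d
      l₂ = solve-∀
      l₃ : ∀ s t u d → s * 0ℤ + (t * 0ℤ + u * (2ℤ * d)) ≡ 2ℤ * u * d
      l₃ = solve-∀

    by-parity : (∃ λ s → (p′ ≡ 2ℤ * s) ⊎ (p′ ≡ 2ℤ * s + 1ℤ)) → (∃ λ t → (q′ ≡ 2ℤ * t) ⊎ (q′ ≡ 2ℤ * t + 1ℤ)) →
                M (- q) q 0ℤ
    -- Every entry of the target is an even multiple of `d`.
    by-parity _ (t , inj₁ q-even) =
      cast (trans (l₁ t d) (cong -_ (sym q≡))) (sym q≡) (l₃ d) (even (- t) t 0ℤ)
      where
      q≡ : q ≡ 2ℤ * t * d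
      q≡ = trans eq (cong (_* d) q-even)
      l₁ : ∀ t d → 2ℤ * - t * d ≡ - (2ℤ * t * d)
      l₁ = solve-∀
      l₃ : ∀ d → 2ℤ * 0ℤ * d ≡ 0ℤ
      l₃ = solve-∀
    -- Modulo `2d` the given triple is (0, d, d), and two rotations turn it into (d, d, 0), the
    -- residue of the target.
    by-parity (s , inj₁ p-even) (t , inj₂ q-odd) =
      cast (trans (l₁ t d) (cong -_ (sym q≡))) (trans (l₂ t d) (sym q≡)) (l₃ d)
        (plus (rot (rot 0dd)) (even (- t - 1ℤ) t 0ℤ))
      where
      p≡ : p ≡ 2ℤ * s * d
      p≡ = trans ep (cong (_* d) p-even)
      q≡ : q ≡ (2ℤ * t + 1ℤ) * d
      q≡ = trans eq (cong (_* d) q-odd)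
      0dd : M 0ℤ d d
      0dd = cast (trans (cong (_+ _) p≡) (m₁ s d)) (trans (cong (_+ _) q≡) (m₂ t d))
              (trans (cong₂ (λ p q → - (p + q) + _) p≡ q≡) (m₃ s t d))
              (plus m (even (- s) (- t) (s + t + 1ℤ)))
        where
        m₁ : ∀ s d → 2ℤ * s * d + 2ℤ * - s * d ≡ 0ℤ
        m₁ = solve-∀
        m₂ : ∀ t d → (2ℤ * t + 1ℤ) * d + 2ℤ * - t * d ≡ d
        m₂ = solve-∀
        m₃ : ∀ s t d → - (2ℤ * s * d + (2ℤ * t + 1ℤ) * d) + 2ℤ * (s + t + 1ℤ) * d ≡ d
        m₃ = solve-∀
      l₁ : ∀ t d → d + 2ℤ * (- t - 1ℤ) * d ≡ - ((2ℤ * t + 1ℤ) * d)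
      l₁ = solve-∀
      l₂ : ∀ t d → d + 2ℤ * t * d ≡ (2ℤ * t + 1ℤ) * d
      l₂ = solve-∀
      l₃ : ∀ d → 0ℤ + 2ℤ * 0ℤ * d ≡ 0ℤ
      l₃ = solve-∀
    -- Here `p + q` is an even multiple of `d`, so the given triple and the target already agree
    -- modulo `2d`.
    by-parity (s , inj₂ p-odd) (t , inj₂ q-odd) =
      cast (trans (cong (_+ _) p≡) (trans (l₁ s t d) (cong -_ (sym q≡)))) (l₂ q d)
        (trans (cong₂ (λ p q → - (p + q) + _) p≡ q≡) (l₃ s t d))
        (plus m (even (- (s + t + 1ℤ)) 0ℤ (s + t + 1ℤ)))
      where
      p≡ : p ≡ (2ℤ * s + 1ℤ) * d
      p≡ = trans ep (cong (_* d) p-odd)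
      q≡ : q ≡ (2ℤ * t + 1ℤ) * d
      q≡ = trans eq (cong (_* d) q-odd)
      l₁ : ∀ s t d → (2ℤ * s + 1ℤ) * d + 2ℤ * - (s + t + 1ℤ) * d ≡ - ((2ℤ * t + 1ℤ) * d)
      l₁ = solve-∀
      l₂ : ∀ q d → q + 2ℤ * 0ℤ * d ≡ q
      l₂ = solve-∀
      l₃ : ∀ s t d → - ((2ℤ * s + 1ℤ) * d + (2ℤ * t + 1ℤ) * d) + 2ℤ * (s + t + 1ℤ) * d ≡ 0ℤ
      l₃ = solve-∀

-- Sign vectors and lattices

sgn : Bool → ℤ → ℤ
sgn s x = if s then - x else x

sgn-xor : ∀ s t x → sgn s (sgn t x) ≡ sgn (s xor t) x
sgn-xor false t     x = refl
sgn-xor true  false x = refl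
sgn-xor true  true  x = ℤ.neg-involutive x

Signs : ℕ → Set
Signs n = Fin n → Bool

_·_ : ∀ {n} → Signs n → (Fin n → ℤ) → Fin n → ℤ
(σ · x) i = sgn (σ i) (x i)

_⊻_ : ∀ {n} → Signs n → Signs n → Signs n
(σ ⊻ τ) i = σ i xor τ i

δ : ∀ {n} → Fin n → Signs n
δ i k = does (k ≟ i)

∅ : ∀ {n} → Signs n
∅ _ = false

-- The motive must respect pointwise equality: sign vectors are functions, and one rebuilt by `cons`
-- agrees with the original only pointwise.
signs-induction : ∀ {n} (P : Signs n → Set) → (∀ {σ τ} → σ ≗ τ → P σ → P τ) →
  P ∅ → (∀ i {σ} → P σ → P (δ i ⊻ σ)) → ∀ σ → P σ
signs-induction {zero}  P resp p∅ step σ = resp (λ ()) p∅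
signs-induction {suc n} P resp p∅ step σ = finish (σ zero) refl
  where
  cons : Bool → Signs n → Signs (suc n)
  cons s τ zero    = s
  cons s τ (suc i) = τ i
  rest : P (cons false (σ ∘ suc))
  rest = signs-induction (λ τ → P (cons false τ))
    (λ e → resp λ { zero → refl ; (suc i) → e i })
    (resp (λ { zero → refl ; (suc i) → refl }) p∅)
    (λ i → resp (λ { zero → refl ; (suc k) → refl }) ∘ step (suc i))
    (σ ∘ suc)
  finish : ∀ s → σ zero ≡ s → P σ
  finish false e = resp (λ { zero → sym e ; (suc i) → refl }) rest
  finish true  e = resp (λ { zero → sym e ; (suc i) → refl }) (step zero rest)

record IsLattice {n} (L : (Fin n → ℤ) → Set) : Set where
  field
    resp : ∀ {x y} → x ≗ y → L x → L y
    zer  : L (λ _ → 0ℤ)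
    plus : ∀ {x y} → L x → L y → L (λ i → x i + y i)
    neg  : ∀ {x} → L x → L (λ i → - x i)

module Lattice {n} {L : (Fin n → ℤ) → Set} (isLattice : IsLattice L) where
  open IsLattice isLattice

  scale : ∀ m {x} → L x → L (λ i → m * x i)
  scale m {x} l = go m
    where
    goℕ : ∀ m → L (λ i → + m * x i)
    goℕ zero    = resp (λ i → sym (ℤ.*-zeroˡ (x i))) zer
    goℕ (suc m) = resp (λ i → sym (ℤ.suc-* (+ m) (x i))) (plus l (goℕ m))
    go : ∀ m → L (λ i → m * x i)
    go (+ m)    = goℕ m
    go -[1+ m ] = resp (λ i → ℤ.neg-distribˡ-* (+ suc m) (x i)) (neg (goℕ (suc m)))

  PreservedBySigns : Signs n → Set
  PreservedBySigns σ = ∀ {x} → L x → L (σ · x)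

  PreservedBySwap : Fin n → Fin n → Set
  PreservedBySwap i j = ∀ {x} → L x → L (x ∘ transpose i j)

  preservedBySigns-resp : ∀ {σ τ} → σ ≗ τ → PreservedBySigns σ → PreservedBySigns τ
  preservedBySigns-resp e p {x} l = resp (λ i → cong (λ s → sgn s (x i)) (e i)) (p l)

  preservedBySigns-⊻ : ∀ {σ τ} → PreservedBySigns σ → PreservedBySigns τ → PreservedBySigns (σ ⊻ τ)
  preservedBySigns-⊻ {σ} {τ} p q {x} l = resp (λ i → sgn-xor (σ i) (τ i) (x i)) (p (q l))

  preservedByPerms : (∀ i j → PreservedBySwap i j) → ∀ (π : Permutation′ n) {x} → L x → L (x ∘ (π ⟨$⟩ʳ_))
  preservedByPerms swaps π {x} l = resp (λ i → cong x (TL.eval-decompose π i)) (go (TL.decompose π) l)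
    where
    go : ∀ ts {x} → L x → L (x ∘ (TL.eval ts ⟨$⟩ʳ_))
    go []             l = l
    go ((i , j) ∷ ts) l = swaps i j (go ts l)

  module _ {a b c l : Fin n} (a≢b : a ≢ b) (a≢c : a ≢ c) (b≢c : b ≢ c)
           (l≢a : l ≢ a) (l≢b : l ≢ b) (l≢c : l ≢ c) where

    vec : ℤ → ℤ → ℤ → Fin n → ℤ
    vec u v w k with k ≟ a
    ... | yes _ = u
    ... | no _ with k ≟ b
    ...   | yes _ = v
    ...   | no _ with k ≟ c
    ...     | yes _ = w
    ...     | no _  = 0ℤ

    vec-unique : ∀ {x u v w} → x a ≡ u → x b ≡ v → x c ≡ w →
      (∀ {k} → k ≢ a → k ≢ b → k ≢ c → x k ≡ 0ℤ) → x ≗ vec u v w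
    vec-unique xa xb xc xo k with k ≟ a
    ... | yes refl = xa
    ... | no k≢a with k ≟ b
    ...   | yes refl = xb
    ...   | no k≢b with k ≟ c
    ...     | yes refl = xc
    ...     | no k≢c = xo k≢a k≢b k≢c

    vec-a : ∀ {u v w} → vec u v w a ≡ u
    vec-a with a ≟ a
    ... | yes _ = refl
    ... | no a≢a = contradiction refl a≢a

    vec-b : ∀ {u v w} → vec u v w b ≡ v
    vec-b with b ≟ a
    ... | yes b≡a = contradiction (sym b≡a) a≢b
    ... | no _ with b ≟ b
    ...   | yes _ = refl
    ...   | no b≢b = contradiction refl b≢b

    vec-c : ∀ {u v w} → vec u v w c ≡ w
    vec-c with c ≟ a
    ... | yes c≡a = contradiction (sym c≡a) a≢c
    ... | no _ with c ≟ b
    ...   | yes c≡b = contradiction (sym c≡b) b≢c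
    ...   | no _ with c ≟ c
    ...     | yes _ = refl
    ...     | no c≢c = contradiction refl c≢c

    vec-other : ∀ {u v w k} → k ≢ a → k ≢ b → k ≢ c → vec u v w k ≡ 0ℤ
    vec-other {k = k} k≢a k≢b k≢c with k ≟ a
    ... | yes k≡a = contradiction k≡a k≢a
    ... | no _ with k ≟ b
    ...   | yes k≡b = contradiction k≡b k≢b
    ...   | no _ with k ≟ c
    ...     | yes k≡c = contradiction k≡c k≢c
    ...     | no _ = refl

    -- The vector `x ∘ κ` minus `x` is supported on `a`, `b`, `c` and has coordinate sum zero.
    -- `antidiagonal` turns it into `x ∘ transpose a b` minus `x`, and adding `x` finishes. The
    -- coordinate `l` absorbs the second sign: the vectors in question vanish there, so the even
    -- change acts on them at `c` alone.
    three-cycle⇒swap : PreservedBySigns (δ c ⊻ δ l) →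
      (∀ {x} → L x → L (x ∘ transpose a b ∘ transpose a c)) → PreservedBySwap a b
    three-cycle⇒swap even cyc {x} lx =
      resp eq (plus (antidiagonal start) lx)
      where
      κ : Fin n → Fin n
      κ = transpose a b ∘ transpose a c
      κ-a : κ a ≡ c
      κ-a = trans (cong (transpose a b) (transpose-first a c)) (transpose-other (a≢c ∘ sym) (b≢c ∘ sym))
      κ-b : κ b ≡ a
      κ-b = trans (cong (transpose a b) (transpose-other (a≢b ∘ sym) b≢c)) (transpose-second a b)
      κ-c : κ c ≡ b
      κ-c = trans (cong (transpose a b) (transpose-second a c)) (transpose-first a b)
      κ-other : ∀ {k} → k ≢ a → k ≢ b → k ≢ c → κ k ≡ k
      κ-other k≢a k≢b k≢c = trans (cong (transpose a b) (transpose-other k≢a k≢c)) (transpose-other k≢a k≢b)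

      M : ℤ → ℤ → ℤ → Set
      M u v w = L (vec u v w)

      keep : ∀ {k} → k ≢ c → k ≢ l → (δ c ⊻ δ l) k ≡ false
      keep {k} k≢c k≢l rewrite dec-false (k ≟ c) k≢c | dec-false (k ≟ l) k≢l = refl

      flip-c : (δ c ⊻ δ l) c ≡ true
      flip-c rewrite dec-true (c ≟ c) refl | dec-false (c ≟ l) (l≢c ∘ sym) = refl

      sgn-0 : ∀ s → sgn s 0ℤ ≡ 0ℤ
      sgn-0 false = refl
      sgn-0 true  = refl

      open TripleModule M
        (λ p q → resp (vec-unique (cong₂ _+_ vec-a vec-a) (cong₂ _+_ vec-b vec-b) (cong₂ _+_ vec-c vec-c)
                        (λ p q r → cong₂ _+_ (vec-other p q r) (vec-other p q r))) (plus p q))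
        (λ m p → resp (vec-unique (cong (m *_) vec-a) (cong (m *_) vec-b) (cong (m *_) vec-c)
                        (λ p q r → trans (cong (m *_) (vec-other p q r)) (ℤ.*-zeroʳ m))) (scale m p))
        (λ p → resp (vec-unique (trans (cong (vec _ _ _) κ-a) vec-c) (trans (cong (vec _ _ _) κ-b) vec-a)
                      (trans (cong (vec _ _ _) κ-c) vec-b)
                      (λ p q r → trans (cong (vec _ _ _) (κ-other p q r)) (vec-other p q r))) (cyc p))
        (λ p → resp (vec-unique (cong₂ sgn (keep a≢c (l≢a ∘ sym)) vec-a) (cong₂ sgn (keep b≢c (l≢b ∘ sym)) vec-b)
                      (cong₂ sgn flip-c vec-c)
                      (λ p q r → trans (cong (sgn _) (vec-other p q r)) (sgn-0 _))) (even p))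

      start : M (x c - x a) (x a - x b) (- ((x c - x a) + (x a - x b)))
      start = resp (vec-unique (cong (λ k → x k - x a) κ-a) (cong (λ k → x k - x b) κ-b)
                      (trans (cong (λ k → x k - x c) κ-c) (lem (x a) (x b) (x c)))
                      (λ {k} p q r → trans (cong (λ m → x m - x k) (κ-other p q r)) (ℤ.+-inverseʳ (x k))))
                (plus (cyc lx) (neg lx))
        where
        lem : ∀ a b c → b - c ≡ - ((c - a) + (a - b))
        lem = solve-∀

      eq : ∀ k → vec (- (x a - x b)) (x a - x b) 0ℤ k + x k ≡ x (transpose a b k)
      eq k with k ≟ a
      ... | yes refl = lem (x k) (x b)
        where
        lem : ∀ a b → - (a - b) + a ≡ b
        lem = solve-∀
      ... | no k≢a with k ≟ b
      ...   | yes refl = lem (x a) (x k)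
        where
        lem : ∀ a b → a - b + b ≡ a
        lem = solve-∀
      ...   | no k≢b with k ≟ c
      ...     | yes _ = ℤ.+-identityˡ (x k)
      ...     | no  _ = ℤ.+-identityˡ (x k)

-- Flags and frames

i+j≡i⇒j≡0 : ∀ i {j} → i + j ≡ i → j ≡ 0ℤ
i+j≡i⇒j≡0 i {j} = identityʳ-unique i j

i+1≢i : ∀ i → i + 1ℤ ≢ i
i+1≢i i e with () ← i+j≡i⇒j≡0 i e

i+2≢i : ∀ i → i + 1ℤ + 1ℤ ≢ i
i+2≢i i e with () ← i+j≡i⇒j≡0 i (trans (sym (ℤ.+-assoc i 1ℤ 1ℤ)) e)

i-1≢i : ∀ i → i + -1ℤ ≢ i
i-1≢i i e with () ← i+j≡i⇒j≡0 i e

i±1≢i : ∀ s i → i + sgn s 1ℤ ≢ i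
i±1≢i false = i+1≢i
i±1≢i true  = i-1≢i

±1-injective : ∀ s t i → i + sgn s 1ℤ ≡ i + sgn t 1ℤ → s ≡ t
±1-injective false false i e = refl
±1-injective true  true  i e = refl
±1-injective false true  i e = contradiction (∙-cancelˡ i _ _ e) λ ()
±1-injective true  false i e = contradiction (∙-cancelˡ i _ _ e) λ ()

injective⇒surjective : ∀ {n} (f : Fin n → Fin n) → (∀ {i j} → f i ≡ f j → i ≡ j) → ∀ y → ∃ λ x → f x ≡ y
injective⇒surjective {suc n} f inj y with any? (λ x → f x ≟ y)
... | yes p = p
... | no ¬p with Fin.pigeonhole (ℕ.n<1+n n) (λ x → punchOut {i = y} {j = f x} (λ e → ¬p (x , sym e)))
...   | i , j , i<j , e = contradiction (inj (Fin.punchOut-injective (λ e → ¬p (i , sym e)) (λ e → ¬p (j , sym e)) e)) (Fin.<⇒≢ i<j)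

injective⇒permutation : ∀ {n} (f : Fin n → Fin n) → (∀ {i j} → f i ≡ f j → i ≡ j) → Permutation′ n
injective⇒permutation f inj = permutation f (proj₁ ∘ surj) (proj₂ ∘ surj) (λ x → inj (proj₂ (surj (f x))))
  where surj = injective⇒surjective f inj

-- The flag whose j-face is spanned, from the vertex base, by those coordinate directions i
-- (taken negative where signs i holds) with rank i < j.
record Frame (n : ℕ) : Set where
  constructor frame
  field
    rank  : Permutation′ n
    signs : Signs n
    base  : Fin n → ℤ

  rk : Fin n → ℕ
  rk i = toℕ (rank ⟨$⟩ʳ i)

  -- The linear part of the symmetry that carries the standard flag (origin, positive directions in
  -- natural order) to the flag of this frame.
  transform : (Fin n → ℤ) → Fin n → ℤ
  transform z = signs · (z ∘ (rank ⟨$⟩ʳ_))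

open Frame

InCell : ∀ {n} → Frame n → ℕ → (Fin n → ℤ) → Set
InCell f j y = ∀ i → (rk f i ℕ.< j → (y i ≡ base f i) ⊎ (y i ≡ base f i + sgn (signs f i) 1ℤ))
                   × (j ℕ.≤ rk f i → y i ≡ base f i)

Describes : ∀ {n} → Flag n → Frame n → Set
Describes Φ f = ∀ j y → (y ∈F Flag.face Φ j → InCell f (toℕ j) (lookup y))
                      × (InCell f (toℕ j) (lookup y) → y ∈F Flag.face Φ j)

inCell-resp : ∀ {n} (f : Frame n) {j y z} → y ≗ z → InCell f j y → InCell f j z
inCell-resp f e c i = (λ r → Sum.map (trans (sym (e i))) (trans (sym (e i))) (proj₁ (c i) r))
                    , (λ r → trans (sym (e i)) (proj₂ (c i) r))

base-inCell : ∀ {n} (f : Frame n) j → InCell f j (base f)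
base-inCell f j i = (λ _ → inj₁ refl) , (λ _ → refl)

-- The other end of the edge leaving the base in direction `i`. It tests which faces of the flag
-- contain that direction.
neighbour : ∀ {n} → Frame n → Fin n → Fin n → ℤ
neighbour f i k = if does (k ≟ i) then base f i + sgn (signs f i) 1ℤ else base f k

neighbour-at : ∀ {n} (f : Frame n) i → neighbour f i i ≡ base f i + sgn (signs f i) 1ℤ
neighbour-at f i rewrite dec-true (i ≟ i) refl = refl

neighbour-inCell : ∀ {n} (f : Frame n) i → InCell f (suc (rk f i)) (neighbour f i)
neighbour-inCell f i k with k ≟ i
... | yes refl = (λ _ → inj₂ refl) , (λ r → contradiction r (ℕ.n≮n _))
... | no _     = (λ _ → inj₁ refl) , (λ _ → refl)

lookup-⊕ : ∀ {n} (x y : Point n) j → lookup (x ⊕ y) j ≡ lookup x j + lookup y j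
lookup-⊕ x y j = lookup-zipWith _+_ j x y

Point-ext : ∀ {n} {x y : Point n} → lookup x ≗ lookup y → x ≡ y
Point-ext {x = x} {y} e = trans (sym (tabulate∘lookup x)) (trans (tabulate-cong e) (tabulate∘lookup y))

module _ {n} (h : Sym n) where
  open Sym h renaming (trans to t)

  act-coord : ∀ y j → lookup (act h y) j ≡ sgn (neg (perm ⟨$⟩ˡ j)) (lookup y (perm ⟨$⟩ˡ j)) + lookup t j
  act-coord y j = lookup∘tabulate _ j

  act-image : ∀ y i → lookup (act h y) (perm ⟨$⟩ʳ i) ≡ sgn (neg i) (lookup y i) + lookup t (perm ⟨$⟩ʳ i)
  act-image y i = trans (act-coord y (perm ⟨$⟩ʳ i))
    (cong (λ k → sgn (neg k) (lookup y k) + lookup t (perm ⟨$⟩ʳ i)) (inverseˡ perm))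

  linear : (Fin n → ℤ) → Fin n → ℤ
  linear z j = sgn (neg (perm ⟨$⟩ˡ j)) (z (perm ⟨$⟩ˡ j))

sgn-+ : ∀ s x y → sgn s (x + y) ≡ sgn s x + sgn s y
sgn-+ false x y = refl
sgn-+ true  x y = ℤ.neg-distrib-+ x y

module _ {n} (h : Sym n) {Φ Ψ : Flag n} {f g : Frame n} (dΦ : Describes Φ f) (dΨ : Describes Ψ g)
         (maps : MapsFlag h Φ Ψ) where
  open Sym h renaming (trans to t)

  private
    π : Fin n → Fin n
    π = perm ⟨$⟩ʳ_

    map-inCell : ∀ j y → InCell f (toℕ j) (lookup y) → InCell g (toℕ j) (lookup (act h y))
    map-inCell j y c = proj₁ (dΨ j (act h y)) (proj₁ (maps j) y (proj₂ (dΦ j y) c))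

    rank-face : (k : Frame n) (i : Fin n) → Fin (suc n)
    rank-face k i = suc (rank k ⟨$⟩ʳ i)

    base-image : ∀ i → sgn (neg i) (base f i) + lookup t (π i) ≡ base g (π i)
    base-image i = begin
      sgn (neg i) (base f i) + lookup t (π i)          ≡⟨ cong (λ z → sgn (neg i) z + lookup t (π i)) (lookup∘tabulate (base f) i) ⟨
      sgn (neg i) (lookup x₀ i) + lookup t (π i)       ≡⟨ act-image h x₀ i ⟨
      lookup (act h x₀) (π i)                          ≡⟨ proj₂ (map-inCell zero x₀ (inCell-resp f (sym ∘ lookup∘tabulate (base f)) (base-inCell f 0)) (π i)) z≤n ⟩
      base g (π i)                                     ∎
      where
      open ≡-Reasoning
      x₀ = tabulate (base f)

    neighbour-image : ∀ i → lookup (act h (tabulate (neighbour f i))) (π i) ≡ base g (π i) + sgn (neg i xor signs f i) 1ℤ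
    neighbour-image i = begin
      lookup (act h y) (π i)                                      ≡⟨ act-image h y i ⟩
      sgn (neg i) (lookup y i) + lookup t (π i)                   ≡⟨ cong (λ z → sgn (neg i) z + lookup t (π i)) (trans (lookup∘tabulate _ i) (neighbour-at f i)) ⟩
      sgn (neg i) (base f i + sgn (signs f i) 1ℤ) + lookup t (π i) ≡⟨ cong (_+ lookup t (π i)) (sgn-+ (neg i) (base f i) _) ⟩
      sgn (neg i) (base f i) + sgn (neg i) (sgn (signs f i) 1ℤ) + lookup t (π i) ≡⟨ lem (sgn (neg i) (base f i)) _ (lookup t (π i)) ⟩
      (sgn (neg i) (base f i) + lookup t (π i)) + sgn (neg i) (sgn (signs f i) 1ℤ) ≡⟨ cong₂ _+_ (base-image i) (sgn-xor (neg i) (signs f i) 1ℤ) ⟩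
      base g (π i) + sgn (neg i xor signs f i) 1ℤ                 ∎
      where
      open ≡-Reasoning
      y = tabulate (neighbour f i)
      lem : ∀ a b c → a + b + c ≡ a + c + b
      lem = solve-∀

    neighbour-cell : ∀ i → InCell g (suc (rk f i)) (lookup (act h (tabulate (neighbour f i))))
    neighbour-cell i = map-inCell (rank-face f i) (tabulate (neighbour f i)) (inCell-resp f (sym ∘ lookup∘tabulate (neighbour f i)) (neighbour-inCell f i))

    -- The image of the neighbour differs from `base g` at `π i`, so the face of dimension
    -- `suc (rk f i)` already contains direction `π i`.
    image-rank-≤ : ∀ i → rk g (π i) ℕ.≤ rk f i
    image-rank-≤ i with rk g (π i) ℕ.≤? rk f i
    ... | yes p = p
    ... | no ¬p = contradiction (trans (sym (neighbour-image i)) (proj₂ (neighbour-cell i (π i)) (ℕ.≰⇒> ¬p))) (i±1≢i _ _)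

    -- The same test on a preimage: if `π i` entered earlier than `i`, the neighbour of `base g`
    -- would come from a vertex agreeing with `base f` at `i`, and would then agree with `base g` at
    -- `π i`.
    rank-≤-image : ∀ i → rk f i ℕ.≤ rk g (π i)
    rank-≤-image i with rk f i ℕ.≤? rk g (π i)
    ... | yes p = p
    ... | no ¬p = contradiction contra (i±1≢i (signs g (π i)) (base g (π i)))
      where
      j = rank-face g (π i)
      y′ = tabulate (neighbour g (π i))
      pre = proj₂ (maps j) y′ (proj₂ (dΨ j y′) (inCell-resp g (sym ∘ lookup∘tabulate (neighbour g (π i))) (neighbour-inCell g (π i))))
      y = proj₁ pre
      y-at : lookup y i ≡ base f i
      y-at = proj₂ (proj₁ (dΦ j y) (proj₁ (proj₂ pre)) i) (ℕ.≰⇒> ¬p)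
      contra : base g (π i) + sgn (signs g (π i)) 1ℤ ≡ base g (π i)
      contra = begin
        base g (π i) + sgn (signs g (π i)) 1ℤ       ≡⟨ neighbour-at g (π i) ⟨
        neighbour g (π i) (π i)                     ≡⟨ lookup∘tabulate _ (π i) ⟨
        lookup y′ (π i)                             ≡⟨ cong (λ z → lookup z (π i)) (proj₂ (proj₂ pre)) ⟨
        lookup (act h y) (π i)                      ≡⟨ act-image h y i ⟩
        sgn (neg i) (lookup y i) + lookup t (π i)   ≡⟨ cong (λ z → sgn (neg i) z + lookup t (π i)) y-at ⟩
        sgn (neg i) (base f i) + lookup t (π i)     ≡⟨ base-image i ⟩
        base g (π i)                                ∎
        where open ≡-Reasoning

  mapsFlag⇒rank : ∀ i → rank g ⟨$⟩ʳ (π i) ≡ rank f ⟨$⟩ʳ i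
  mapsFlag⇒rank i = Fin.toℕ-injective (ℕ.≤-antisym (image-rank-≤ i) (rank-≤-image i))

  mapsFlag⇒signs : ∀ i → neg i xor signs f i ≡ signs g (π i)
  mapsFlag⇒signs i with proj₁ (neighbour-cell i (π i)) (s≤s (image-rank-≤ i))
  ... | inj₁ e = contradiction (trans (sym (neighbour-image i)) e) (i±1≢i _ _)
  ... | inj₂ e = ±1-injective _ _ (base g (π i)) (trans (sym (neighbour-image i)) e)

-- Orbits of flags

sgn-self : ∀ s x → sgn s (sgn s x) ≡ x
sgn-self s x = trans (sgn-xor s s x) (cong (λ u → sgn u x) (Bool.xor-same s))

sumℤ-cong : ∀ m {f g : Fin m → ℤ} → f ≗ g → sumℤ m f ≡ sumℤ m g
sumℤ-cong zero    e = refl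
sumℤ-cong (suc m) e = cong₂ _+_ (e zero) (sumℤ-cong m (e ∘ suc))

sumℤ-0 : ∀ m → sumℤ m (λ _ → 0ℤ) ≡ 0ℤ
sumℤ-0 zero    = refl
sumℤ-0 (suc m) = trans (ℤ.+-identityˡ _) (sumℤ-0 m)

sumℤ-+ : ∀ m (f g : Fin m → ℤ) → sumℤ m (λ i → f i + g i) ≡ sumℤ m f + sumℤ m g
sumℤ-+ zero    f g = refl
sumℤ-+ (suc m) f g = trans (cong (λ u → f zero + g zero + u) (sumℤ-+ m (f ∘ suc) (g ∘ suc))) (lem (f zero) (g zero) _ _)
  where
  lem : ∀ a b c d → a + b + (c + d) ≡ a + c + (b + d)
  lem = solve-∀

sumℤ-neg : ∀ m (f : Fin m → ℤ) → sumℤ m (λ i → - f i) ≡ - sumℤ m f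
sumℤ-neg zero    f = refl
sumℤ-neg (suc m) f = trans (cong (λ u → - f zero + u) (sumℤ-neg m (f ∘ suc))) (sym (ℤ.neg-distrib-+ (f zero) _))

module _ {n} (b : Fin n → Point n) where

  Lat : (Fin n → ℤ) → Set
  Lat z = Σ (Fin n → ℤ) λ c → ∀ j → z j ≡ sumℤ n (λ i → c i * lookup (b i) j)

  Lat-isLattice : IsLattice Lat
  Lat-isLattice = record
    { resp = λ e (c , p) → c , λ j → trans (sym (e j)) (p j)
    ; zer  = (λ _ → 0ℤ) , λ j → sym (trans (sumℤ-cong n (λ i → ℤ.*-zeroˡ (lookup (b i) j))) (sumℤ-0 n))
    ; plus = λ (c , p) (d , q) → (λ i → c i + d i) , λ j → sym
        (trans (sumℤ-cong n (λ i → ℤ.*-distribʳ-+ (lookup (b i) j) (c i) (d i)))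
          (trans (sumℤ-+ n _ _) (sym (cong₂ _+_ (p j) (q j)))))
    ; neg  = λ (c , p) → (λ i → - c i) , λ j → sym
        (trans (sumℤ-cong n (λ i → sym (ℤ.neg-distribˡ-* (c i) (lookup (b i) j))))
          (trans (sumℤ-neg n _) (sym (cong -_ (p j)))))
    }

  open IsLattice Lat-isLattice using (resp)

  inLattice⇒Lat : ∀ {l} → InLattice b l → Lat (lookup l)
  inLattice⇒Lat (c , refl) = c , λ j → lookup∘tabulate _ j

  Lat⇒inLattice : ∀ {z} → Lat z → InLattice b (tabulate z)
  Lat⇒inLattice (c , p) = c , tabulate-cong p

  -- Says that the linear map taking each `transform f z` to `transform g z` sends the lattice onto
  -- itself, phrased without an inverse. Base points are absent because all translations commute
  -- with those of the lattice.
  record Equivalent (f g : Frame n) : Set where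
    constructor equivalent
    field
      images : ∀ z → (Lat (transform f z) → Lat (transform g z)) × (Lat (transform g z) → Lat (transform f z))

  translation-image : ∀ (h : Sym n) {l l′} → (∀ x → act h (x ⊕ l) ≡ act h x ⊕ l′) → ∀ j → lookup l′ j ≡ linear h (lookup l) j
  translation-image h {l} {l′} e j = ∙-cancelˡ c (lookup l′ j) (linear h (lookup l) j) (begin
    c + lookup l′ j                                         ≡⟨ cong (_+ lookup l′ j) (act-coord h zeroP j) ⟨
    lookup (act h zeroP) j + lookup l′ j                    ≡⟨ lookup-⊕ (act h zeroP) l′ j ⟨
    lookup (act h zeroP ⊕ l′) j                             ≡⟨ cong (λ u → lookup u j) (e zeroP) ⟨
    lookup (act h (zeroP ⊕ l)) j                            ≡⟨ act-coord h (zeroP ⊕ l) j ⟩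
    sgn (neg i) (lookup (zeroP ⊕ l) i) + lookup t j         ≡⟨ cong (λ u → sgn (neg i) u + lookup t j) (lookup-⊕ zeroP l i) ⟩
    sgn (neg i) (lookup zeroP i + lookup l i) + lookup t j  ≡⟨ cong (_+ lookup t j) (sgn-+ (neg i) (lookup zeroP i) (lookup l i)) ⟩
    sgn (neg i) (lookup zeroP i) + linear h (lookup l) j + lookup t j ≡⟨ lem (sgn (neg i) (lookup zeroP i)) _ _ ⟩
    c + linear h (lookup l) j                               ∎)
    where
    open ≡-Reasoning
    open Sym h renaming (trans to t) using (perm; neg)
    i = perm ⟨$⟩ˡ j
    c = sgn (neg i) (lookup zeroP i) + lookup t j
    lem : ∀ a b c → a + b + c ≡ a + c + b
    lem = solve-∀

  linear-translation : ∀ (h : Sym n) l x → act h (x ⊕ l) ≡ act h x ⊕ tabulate (linear h (lookup l))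
  linear-translation h l x = Point-ext λ j → begin
    lookup (act h (x ⊕ l)) j                                          ≡⟨ act-coord h (x ⊕ l) j ⟩
    sgn (neg (i j)) (lookup (x ⊕ l) (i j)) + lookup t j               ≡⟨ cong (λ u → sgn (neg (i j)) u + lookup t j) (lookup-⊕ x l (i j)) ⟩
    sgn (neg (i j)) (lookup x (i j) + lookup l (i j)) + lookup t j    ≡⟨ cong (_+ lookup t j) (sgn-+ (neg (i j)) (lookup x (i j)) _) ⟩
    linear h (lookup x) j + linear h (lookup l) j + lookup t j        ≡⟨ lem (linear h (lookup x) j) _ _ ⟩
    (linear h (lookup x) j + lookup t j) + linear h (lookup l) j      ≡⟨ cong₂ _+_ (act-coord h x j) (lookup∘tabulate _ j) ⟨
    lookup (act h x) j + lookup (tabulate (linear h (lookup l))) j    ≡⟨ lookup-⊕ (act h x) _ j ⟨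
    lookup (act h x ⊕ tabulate (linear h (lookup l))) j               ∎
    where
    open ≡-Reasoning
    open Sym h renaming (trans to t) using (perm; neg)
    i : Fin n → Fin n
    i = perm ⟨$⟩ˡ_
    lem : ∀ a b c → a + b + c ≡ a + c + b
    lem = solve-∀

  -- Since `h` matches ranks and signs, its linear part sends `transform f z` to `transform g z`;
  -- normalising means that this linear part maps the lattice onto itself.
  sameOrbit⇒equivalent : ∀ {Φ Ψ f g} → Describes Φ f → Describes Ψ g → SameOrbit b Φ Ψ → Equivalent f g
  sameOrbit⇒equivalent {Φ} {Ψ} {f} {g} dΦ dΨ (h , (into , onto) , maps) = equivalent λ z → to z , from z
    where
    open Sym h renaming (trans to t) using (perm; neg)
    rank-eq : ∀ i → rank g ⟨$⟩ʳ (perm ⟨$⟩ʳ i) ≡ rank f ⟨$⟩ʳ i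
    rank-eq = mapsFlag⇒rank h {Φ} {Ψ} {f} {g} dΦ dΨ maps
    signs-eq : ∀ i → neg i xor signs f i ≡ signs g (perm ⟨$⟩ʳ i)
    signs-eq = mapsFlag⇒signs h {Φ} {Ψ} {f} {g} dΦ dΨ maps
    image : ∀ z i → sgn (neg i) (transform f z i) ≡ transform g z (perm ⟨$⟩ʳ i)
    image z i = trans (sgn-xor (neg i) (signs f i) _) (cong₂ (λ s k → sgn s (z k)) (signs-eq i) (sym (rank-eq i)))
    linear-transform : ∀ z j → linear h (transform f z) j ≡ transform g z j
    linear-transform z j = trans (image z (perm ⟨$⟩ˡ j)) (cong (transform g z) (inverseʳ perm))
    to : ∀ z → Lat (transform f z) → Lat (transform g z)
    to z p with into (tabulate (transform f z)) (Lat⇒inLattice p)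
    ... | l′ , l′∈ , e = resp
      (λ j → trans (translation-image h e j)
               (trans (cong (sgn (neg (perm ⟨$⟩ˡ j))) (lookup∘tabulate (transform f z) (perm ⟨$⟩ˡ j))) (linear-transform z j)))
      (inLattice⇒Lat l′∈)
    from : ∀ z → Lat (transform g z) → Lat (transform f z)
    from z p with onto (tabulate (transform g z)) (Lat⇒inLattice p)
    ... | l , l∈ , e = resp (λ i → begin
        lookup l i                                        ≡⟨ sgn-self (neg i) _ ⟨
        sgn (neg i) (sgn (neg i) (lookup l i))            ≡⟨ cong (sgn (neg i)) (cong (λ k → sgn (neg k) (lookup l k)) (inverseˡ perm)) ⟨
        sgn (neg i) (linear h (lookup l) (perm ⟨$⟩ʳ i))   ≡⟨ cong (sgn (neg i)) (translation-image h e (perm ⟨$⟩ʳ i)) ⟨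
        sgn (neg i) (lookup (tabulate (transform g z)) (perm ⟨$⟩ʳ i)) ≡⟨ cong (sgn (neg i)) (lookup∘tabulate _ (perm ⟨$⟩ʳ i)) ⟩
        sgn (neg i) (transform g z (perm ⟨$⟩ʳ i))         ≡⟨ cong (sgn (neg i)) (image z i) ⟨
        sgn (neg i) (sgn (neg i) (transform f z i))       ≡⟨ sgn-self (neg i) _ ⟩
        transform f z i                                   ∎)
      (inLattice⇒Lat l∈)
      where open ≡-Reasoning

  -- Transitivity on flags: `π` matches ranks, `ν` matches directions, and the translation is chosen
  -- so that `base f` goes to `base g`.
  module Transport (f g : Frame n) where
    π : Permutation′ n
    π = rank f ∘ₚ Perm.flip (rank g)

    ν : Signs n
    ν i = signs f i xor signs g (π ⟨$⟩ʳ i)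

    h : Sym n
    h = record { perm = π ; neg = ν ; trans = tabulate (λ j → base g j - sgn (ν (π ⟨$⟩ˡ j)) (base f (π ⟨$⟩ˡ j))) }

    rank-π : ∀ j → rank f ⟨$⟩ʳ (π ⟨$⟩ˡ j) ≡ rank g ⟨$⟩ʳ j
    rank-π j = inverseʳ (rank f)

    ν-signs : ∀ j → ν (π ⟨$⟩ˡ j) xor signs f (π ⟨$⟩ˡ j) ≡ signs g j
    ν-signs j = trans (lem (signs f (π ⟨$⟩ˡ j)) _) (cong (signs g) (inverseʳ π))
      where
      lem : ∀ s t → (s xor t) xor s ≡ t
      lem false t = Bool.xor-identityʳ t
      lem true false = refl
      lem true true = refl

    act-h : ∀ y j → lookup (act h y) j ≡ base g j + sgn (ν (π ⟨$⟩ˡ j)) (lookup y (π ⟨$⟩ˡ j) - base f (π ⟨$⟩ˡ j))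
    act-h y j = trans (act-coord h y j) (trans (cong (λ u → sgn (ν i) (lookup y i) + u) (lookup∘tabulate _ j))
                  (lem (ν i) (lookup y i) (base g j) (base f i)))
      where
      i = π ⟨$⟩ˡ j
      lem₀ : ∀ y b c → y + (b - c) ≡ b + (y - c)
      lem₀ = solve-∀
      lem₁ : ∀ y b c → - y + (b - - c) ≡ b + - (y - c)
      lem₁ = solve-∀
      lem : ∀ s y b c → sgn s y + (b - sgn s c) ≡ b + sgn s (y - c)
      lem false = lem₀
      lem true  = lem₁

    act-h-base : ∀ y j → lookup y (π ⟨$⟩ˡ j) ≡ base f (π ⟨$⟩ˡ j) → lookup (act h y) j ≡ base g j
    act-h-base y j e = trans (act-h y j)
      (trans (cong (λ u → base g j + sgn (ν (π ⟨$⟩ˡ j)) u) (ℤ.i≡j⇒i-j≡0 e)) (lem (ν (π ⟨$⟩ˡ j)) (base g j)))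
      where
      lem : ∀ s b → b + sgn s 0ℤ ≡ b
      lem false b = ℤ.+-identityʳ b
      lem true  b = ℤ.+-identityʳ b

    act-h-step : ∀ y j → lookup y (π ⟨$⟩ˡ j) ≡ base f (π ⟨$⟩ˡ j) + sgn (signs f (π ⟨$⟩ˡ j)) 1ℤ →
      lookup (act h y) j ≡ base g j + sgn (signs g j) 1ℤ
    act-h-step y j e = trans (act-h y j) (cong (λ u → base g j + u)
      (trans (cong (sgn (ν i)) (trans (cong (_- base f i) e) (lem (base f i) _)))
        (trans (sgn-xor (ν i) (signs f i) 1ℤ) (cong (λ s → sgn s 1ℤ) (ν-signs j)))))
      where
      i = π ⟨$⟩ˡ j
      lem : ∀ a b → a + b - a ≡ b
      lem = solve-∀

    act-h-inCell : ∀ {j} y → InCell f j (lookup y) → InCell g j (lookup (act h y))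
    act-h-inCell {j} y c k = below , above
      where
      i = π ⟨$⟩ˡ k
      rk-eq : rk f i ≡ rk g k
      rk-eq = cong toℕ (rank-π k)
      below : rk g k ℕ.< j → (lookup (act h y) k ≡ base g k) ⊎ (lookup (act h y) k ≡ base g k + sgn (signs g k) 1ℤ)
      below r with proj₁ (c i) (subst (ℕ._< j) (sym rk-eq) r)
      ... | inj₁ e = inj₁ (act-h-base y k e)
      ... | inj₂ e = inj₂ (act-h-step y k e)
      above : j ℕ.≤ rk g k → lookup (act h y) k ≡ base g k
      above r = act-h-base y k (proj₂ (c i) (subst (j ℕ.≤_) (sym rk-eq) r))

    linear-transform : ∀ z j → linear h (transform f z) j ≡ transform g z j
    linear-transform z j = trans (sgn-xor (ν i) (signs f i) _) (cong₂ (λ s k → sgn s (z k)) (ν-signs j) (rank-π j))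
      where i = π ⟨$⟩ˡ j

  untransform : Frame n → (Fin n → ℤ) → Fin n → ℤ
  untransform f y k = sgn (signs f (rank f ⟨$⟩ˡ k)) (y (rank f ⟨$⟩ˡ k))

  transform-untransform : ∀ f y → transform f (untransform f y) ≗ y
  transform-untransform f y i = trans (cong (λ k → sgn (signs f i) (sgn (signs f k) (y k))) (inverseˡ (rank f))) (sgn-self (signs f i) (y i))

  equivalent⇒sameOrbit : ∀ {Φ Ψ f g} → Describes Φ f → Describes Ψ g → Equivalent f g → SameOrbit b Φ Ψ
  equivalent⇒sameOrbit {Φ} {Ψ} {f} {g} dΦ dΨ (equivalent eqv) = h , (into , onto) , λ j → forth j , back j
    where
    open Transport f g
    module T′ = Transport g f

    sends : ∀ y → Lat y → Lat (linear h y)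
    sends y p = resp
      (λ j → trans (sym (linear-transform z j)) (cong (sgn _) (transform-untransform f y (π ⟨$⟩ˡ j))))
      (proj₁ (eqv z) (resp (sym ∘ transform-untransform f y) p))
      where z = untransform f y

    into : ∀ l → InLattice b l → Σ _ (λ l′ → InLattice b l′ × (∀ x → act h (x ⊕ l) ≡ act h x ⊕ l′))
    into l l∈ = tabulate (linear h (lookup l)) , Lat⇒inLattice (sends (lookup l) (inLattice⇒Lat l∈)) , linear-translation h l

    onto : ∀ l′ → InLattice b l′ → Σ _ (λ l → InLattice b l × (∀ x → act h (x ⊕ l) ≡ act h x ⊕ l′))
    onto l′ l′∈ = l , Lat⇒inLattice (proj₂ (eqv z) (resp (sym ∘ transform-untransform g (lookup l′)) (inLattice⇒Lat l′∈)))
      , λ x → trans (linear-translation h l x) (cong (act h x ⊕_) (Point-ext λ j →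
          trans (lookup∘tabulate _ j) (trans (cong (sgn _) (lookup∘tabulate _ (π ⟨$⟩ˡ j)))
            (trans (linear-transform z j) (transform-untransform g (lookup l′) j)))))
      where
      z = untransform g (lookup l′)
      l = tabulate (transform f z)

    forth : ∀ j y → y ∈F Flag.face Φ j → act h y ∈F Flag.face Ψ j
    forth j y y∈ = proj₂ (dΨ j (act h y)) (act-h-inCell y (proj₁ (dΦ j y) y∈))

    back : ∀ j x → x ∈F Flag.face Ψ j → ∃ (λ y → y ∈F Flag.face Φ j × act h y ≡ x)
    back j x x∈ = act T′.h x , proj₂ (dΦ j (act T′.h x)) (T′.act-h-inCell x (proj₁ (dΨ j x) x∈)) , Point-ext inverse
      where
      inverse : ∀ k → lookup (act h (act T′.h x)) k ≡ lookup x k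
      inverse k = begin
        lookup (act h (act T′.h x)) k
          ≡⟨ act-h (act T′.h x) k ⟩
        base g k + sgn (ν i) (lookup (act T′.h x) i - base f i)
          ≡⟨ cong (λ u → base g k + sgn (ν i) (u - base f i)) (T′.act-h x i) ⟩
        base g k + sgn (ν i) (base f i + sgn (T′.ν i′) (lookup x i′ - base g i′) - base f i)
          ≡⟨ cong (λ u → base g k + sgn (ν i) u) (lem₁ (base f i) _) ⟩
        base g k + sgn (ν i) (sgn (T′.ν i′) (lookup x i′ - base g i′))
          ≡⟨ cong (λ u → base g k + sgn (ν i) (sgn (T′.ν u) (lookup x u - base g u))) (inverseʳ π) ⟩
        base g k + sgn (ν i) (sgn (T′.ν k) (lookup x k - base g k))
          ≡⟨ cong (λ s → base g k + sgn s (sgn (T′.ν k) (lookup x k - base g k))) (trans (cong (λ u → signs f i xor signs g u) (inverseʳ π)) (Bool.xor-comm (signs f i) (signs g k))) ⟩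
        base g k + sgn (T′.ν k) (sgn (T′.ν k) (lookup x k - base g k))
          ≡⟨ cong (λ u → base g k + u) (sgn-self (T′.ν k) _) ⟩
        base g k + (lookup x k - base g k)
          ≡⟨ lem₂ (base g k) (lookup x k) ⟩
        lookup x k ∎
        where
        open ≡-Reasoning
        i = π ⟨$⟩ˡ k
        i′ = T′.π ⟨$⟩ˡ i
        lem₁ : ∀ a b → a + b - a ≡ b
        lem₁ = solve-∀
        lem₂ : ∀ a b → a + (b - a) ≡ b
        lem₂ = solve-∀

-- Every frame is realised by a flag, and every flag by a frame

∣tabulate∣ : ∀ {n} (p : Fin n → Bool) → Subset.∣ tabulate p ∣ ≡ sum (λ i → if p i then 1 else 0)
∣tabulate∣ {zero}  p = refl
∣tabulate∣ {suc n} p with p zero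
... | true  = cong suc (∣tabulate∣ (p ∘ suc))
... | false = ∣tabulate∣ (p ∘ suc)

sum-below : ∀ {n} (j : Fin (suc n)) → sum {n} (λ i → if toℕ i ℕ.<ᵇ toℕ j then 1 else 0) ≡ toℕ j
sum-below {n}     zero    = sum-replicate-zero n
sum-below {suc n} (suc j) = cong suc (sum-below j)

module _ {n} (ρ : Permutation′ n) (σ : Signs n) where

  centred : Frame n
  centred = frame ρ σ (λ _ → 0ℤ)

  private
    inner : ℕ → Fin n → Bool
    inner j i = rk centred i ℕ.<ᵇ j

    -- A face is stored by its lowest corner, so a direction taken negatively from the origin moves
    -- that corner to -1 once it is spanned.
    corner : Bool → Bool → ℤ
    corner true  true  = -1ℤ
    corner true  false = 0ℤ
    corner false _     = 0ℤ

    cell : ℕ → Face n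
    cell j = tabulate (λ i → corner (inner j i) (σ i)) , tabulate (inner j)

    ∈-tabulate : ∀ {p : Fin n → Bool} {i} → p i ≡ true → i ∈ tabulate p
    ∈-tabulate {p} {i} e = lookup⇒[]= i _ (trans (lookup∘tabulate p i) e)

    ∉-tabulate : ∀ {p : Fin n → Bool} {i} → p i ≡ false → i ∉ tabulate p
    ∉-tabulate {p} {i} e i∈ = contradiction (trans (sym ([]=⇒lookup i∈)) (trans (lookup∘tabulate p i) e)) λ ()

    inner-true : ∀ {j i} → rk centred i ℕ.< j → inner j i ≡ true
    inner-true r = Bool.T-≡ .Equivalence.to (ℕ.<⇒<ᵇ r)

    inner-false : ∀ {j i} → j ℕ.≤ rk centred i → inner j i ≡ false
    inner-false {j} {i} r with inner j i in e
    ... | false = refl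
    ... | true  = contradiction (ℕ.<ᵇ⇒< _ j (Bool.T-≡ .Equivalence.from e)) (ℕ.≤⇒≯ r)

    cell⇒inCell : ∀ j y → y ∈F cell j → InCell centred j (lookup y)
    cell⇒inCell j y y∈ i = below , above
      where
      v = λ i → corner (inner j i) (σ i)
      below : rk centred i ℕ.< j → (lookup y i ≡ 0ℤ) ⊎ (lookup y i ≡ 0ℤ + sgn (σ i) 1ℤ)
      below r with proj₁ (y∈ i) (∈-tabulate (inner-true r)) | lookup∘tabulate v i | inner-true {j} {i} r
      ... | yi | vi | inn rewrite vi | inn with σ i | yi
      ...   | false | inj₁ e = inj₁ e
      ...   | false | inj₂ e = inj₂ e
      ...   | true  | inj₁ e = inj₂ e
      ...   | true  | inj₂ e = inj₁ e
      above : j ℕ.≤ rk centred i → lookup y i ≡ 0ℤ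
      above r = trans (proj₂ (y∈ i) (∉-tabulate (inner-false r)))
        (trans (lookup∘tabulate v i) (cong (λ u → corner u (σ i)) (inner-false {j} {i} r)))

    inCell⇒cell : ∀ j y → InCell centred j (lookup y) → y ∈F cell j
    inCell⇒cell j y c i with rk centred i ℕ.<? j
    ... | yes r = (λ _ → inside) , λ i∉ → contradiction (∈-tabulate (inner-true r)) i∉
      where
      v = λ i → corner (inner j i) (σ i)
      inside : (lookup y i ≡ lookup (tabulate v) i) ⊎ (lookup y i ≡ lookup (tabulate v) i + 1ℤ)
      inside with proj₁ (c i) r | lookup∘tabulate v i | inner-true {j} {i} r
      ... | yi | vi | inn rewrite vi | inn with σ i | yi
      ...   | false | inj₁ e = inj₁ e
      ...   | false | inj₂ e = inj₂ e
      ...   | true  | inj₁ e = inj₂ e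
      ...   | true  | inj₂ e = inj₁ e
    ... | no ¬r = (λ i∈ → contradiction i∈ (∉-tabulate (inner-false (ℕ.≮⇒≥ ¬r))))
      , λ _ → trans (proj₂ (c i) (ℕ.≮⇒≥ ¬r))
                (sym (trans (lookup∘tabulate _ i) (cong (λ u → corner u (σ i)) (inner-false {j} {i} (ℕ.≮⇒≥ ¬r)))))

    inCell-suc : ∀ {j y} → InCell centred j y → InCell centred (suc j) y
    inCell-suc {j} {y} c i = below , λ r → proj₂ (c i) (ℕ.≤-trans (ℕ.n≤1+n j) r)
      where
      below : rk centred i ℕ.< suc j → (y i ≡ 0ℤ) ⊎ (y i ≡ 0ℤ + sgn (σ i) 1ℤ)
      below r with rk centred i ℕ.<? j
      ... | yes p = proj₁ (c i) p
      ... | no ¬p = inj₁ (proj₂ (c i) (ℕ.≮⇒≥ ¬p))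

  centredFlag : Flag n
  centredFlag = record
    { face  = λ j → cell (toℕ j)
    -- Reindexing by `ρ` reduces the count to the numbers below `j`.
    ; dimOk = λ j → trans (∣tabulate∣ (inner (toℕ j)))
        (trans (sym (sum-permute (λ i → if toℕ i ℕ.<ᵇ toℕ j then 1 else 0) ρ)) (sum-below j))
    ; chain = λ j y y∈ → inCell⇒cell (suc (toℕ j)) y (inCell-suc
        (subst (λ k → InCell centred k (lookup y)) (Fin.toℕ-inject₁ j) (cell⇒inCell (toℕ (inject₁ j)) y y∈)))
    }

  centredFlag-described : Describes centredFlag centred
  centredFlag-described j y = cell⇒inCell (toℕ j) y , inCell⇒cell (toℕ j) y

module _ {n} (F G : Face n) (F⊆G : F ⊆F G) where
  private
    v w : Point n
    v = proj₁ F
    w = proj₁ G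
    S T′ : Subset n
    S = proj₂ F
    T′ = proj₂ G

    v∈G : v ∈F G
    v∈G = F⊆G v λ i → (λ _ → inj₁ refl) , (λ _ → refl)

    bump : Fin n → Point n
    bump i = tabulate λ k → if does (k ≟ i) then lookup v i + 1ℤ else lookup v k

    bump-at : ∀ i → lookup (bump i) i ≡ lookup v i + 1ℤ
    bump-at i = trans (lookup∘tabulate _ i) (cong (λ u → if u then lookup v i + 1ℤ else lookup v i) (dec-true (i ≟ i) refl))

    bump∈G : ∀ {i} → i ∈ S → bump i ∈F G
    bump∈G {i} i∈S = F⊆G (bump i) inF
      where
      inF : bump i ∈F F
      inF k rewrite lookup∘tabulate (λ k → if does (k ≟ i) then lookup v i + 1ℤ else lookup v k) k with k ≟ i
      ... | yes refl = (λ _ → inj₂ refl) , λ i∉S → contradiction i∈S i∉S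
      ... | no  _    = (λ _ → inj₁ refl) , λ _ → refl

  ⊆F⇒⊆ : ∀ {i} → i ∈ S → i ∈ T′
  ⊆F⇒⊆ {i} i∈S with i ∈? T′
  ... | yes i∈T = i∈T
  ... | no  i∉T = contradiction
    (trans (sym (bump-at i)) (trans (proj₂ (bump∈G i∈S i) i∉T) (sym (proj₂ (v∈G i) i∉T)))) (i+1≢i (lookup v i))

  -- Both `v` and `bump i` lie in `G`, which allows just two consecutive values at `i`; hence the
  -- lower values coincide.
  ⊆F⇒corner-inside : ∀ {i} → i ∈ S → lookup w i ≡ lookup v i
  ⊆F⇒corner-inside {i} i∈S with proj₁ (v∈G i) (⊆F⇒⊆ i∈S)
  ... | inj₁ e = sym e
  ... | inj₂ e with proj₁ (bump∈G i∈S i) (⊆F⇒⊆ i∈S)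
  ...   | inj₁ e′ = contradiction (trans (cong (_+ 1ℤ) (sym e)) (trans (sym (bump-at i)) e′)) (i+2≢i (lookup w i))
  ...   | inj₂ e′ = contradiction (trans (cong (_+ 1ℤ) (sym e)) (trans (sym (bump-at i)) e′)) (i+1≢i (lookup w i + 1ℤ))

  ⊆F⇒corner-outside : ∀ {i} → i ∉ T′ → lookup w i ≡ lookup v i
  ⊆F⇒corner-outside {i} i∉T = sym (proj₂ (v∈G i) i∉T)

  ⊆F⇒corner-new : ∀ {i} → i ∈ T′ → (lookup v i ≡ lookup w i) ⊎ (lookup v i ≡ lookup w i + 1ℤ)
  ⊆F⇒corner-new {i} = proj₁ (v∈G i)

module FrameOf {n} (Φ : Flag n) where
  open Flag Φ

  corner : Fin (suc n) → Fin n → ℤ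
  corner j = lookup (proj₁ (face j))

  span : Fin (suc n) → Subset n
  span j = proj₂ (face j)

  cornerBelow : Bool → ℤ → ℤ
  cornerBelow s x = if s then x - 1ℤ else x

  -- Along a flag a coordinate joins the span at a single step, and its corner can change only
  -- there. It drops by one when the initial vertex is the upper end of the new edge, so `sign`
  -- marks a negative direction.
  record Entry (i : Fin n) : Set where
    field
      at     : Fin n
      sign   : Bool
      before : ∀ j → toℕ j ℕ.≤ toℕ at → i ∉ span j × corner j i ≡ corner zero i
      after  : ∀ j → toℕ at ℕ.< toℕ j → i ∈ span j × corner j i ≡ cornerBelow sign (corner zero i)

  span-zero : ∀ {i} → i ∉ span zero
  span-zero {i} i∈ with () ← subst (Subset.∣ span zero Subset.- i ∣ ℕ.<_) (dimOk zero) (x∈p⇒∣p-x∣<∣p∣ i∈)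

  span-top : ∀ {i} → i ∈ span (fromℕ n)
  span-top {i} = subst (i ∈_) (sym (∣p∣≡n⇒p≡⊤ (trans (dimOk (fromℕ n)) (Fin.toℕ-fromℕ n)))) ∈⊤

  span-mono : ∀ {i j k} → toℕ j ℕ.≤ toℕ k → i ∈ span j → i ∈ span k
  span-mono {i} j≤k i∈ = <-weakInduction-startingFrom (λ j → i ∈ span j) i∈
    (λ j → ⊆F⇒⊆ (face (inject₁ j)) (face (suc j)) (chain j)) j≤k

  -- A discrete intermediate value argument: the first span is empty and the last is full.
  jump : ∀ i → ∃ λ r → i ∉ span (inject₁ r) × i ∈ span (suc r)
  jump i with any? (λ r → ¬? (i ∈? span (inject₁ r)) ×-dec (i ∈? span (suc r)))
  ... | yes p = p
  ... | no ¬p = contradiction (span-top {i}) (never (fromℕ n))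
    where
    never : ∀ j → i ∉ span j
    never = <-weakInduction _ span-zero (λ r i∉ i∈ → ¬p (r , i∉ , i∈))

  corner-before : ∀ {i} j → i ∉ span j → corner j i ≡ corner zero i
  corner-before {i} = <-weakInduction (λ j → i ∉ span j → corner j i ≡ corner zero i) (λ _ → refl)
    λ j ih i∉ → trans (⊆F⇒corner-outside (face (inject₁ j)) (face (suc j)) (chain j) i∉)
                  (ih (i∉ ∘ ⊆F⇒⊆ (face (inject₁ j)) (face (suc j)) (chain j)))

  corner-after : ∀ {i r} → i ∈ span r → ∀ {j} → toℕ r ℕ.≤ toℕ j → i ∈ span j × corner j i ≡ corner r i
  corner-after {i} {r} i∈ = <-weakInduction-startingFrom (λ j → i ∈ span j × corner j i ≡ corner r i) (i∈ , refl)
    λ j (i∈j , e) → ⊆F⇒⊆ (face (inject₁ j)) (face (suc j)) (chain j) i∈j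
                  , trans (⊆F⇒corner-inside (face (inject₁ j)) (face (suc j)) (chain j) i∈j) e

  entry : ∀ i → Entry i
  entry i with jump i
  ... | r , i∉ , i∈ = record { at = r ; sign = proj₁ signed ; before = before ; after = after }
    where
    before : ∀ j → toℕ j ℕ.≤ toℕ r → i ∉ span j × corner j i ≡ corner zero i
    before j j≤r = i∉j , corner-before j i∉j
      where
      i∉j : i ∉ span j
      i∉j = i∉ ∘ span-mono (subst (toℕ j ℕ.≤_) (sym (Fin.toℕ-inject₁ r)) j≤r)
    signed : ∃ λ s → corner (suc r) i ≡ cornerBelow s (corner zero i)
    signed with ⊆F⇒corner-new (face (inject₁ r)) (face (suc r)) (chain r) i∈ | corner-before (inject₁ r) i∉
    ... | inj₁ e | e₀ = false , trans (sym e) e₀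
    ... | inj₂ e | e₀ = true  , trans (lem (corner (suc r) i)) (cong (_- 1ℤ) (trans (sym e) e₀))
      where
      lem : ∀ a → a ≡ a + 1ℤ - 1ℤ
      lem = solve-∀
    after : ∀ j → toℕ r ℕ.< toℕ j → i ∈ span j × corner j i ≡ cornerBelow (proj₁ signed) (corner zero i)
    after j r<j with corner-after i∈ r<j
    ... | i∈j , e = i∈j , trans e (proj₂ signed)

  open Entry

  -- Two coordinates entering together would raise the dimension by two between consecutive faces.
  entry-injective : ∀ {i k} → at (entry i) ≡ at (entry k) → i ≡ k
  entry-injective {i} {k} e with i ≟ k
  ... | yes p = p
  ... | no i≢k = contradiction two-new (ℕ.<⇒≱ one-new)
    where
    r = at (entry i)
    S T′ : Subset n
    S  = span (inject₁ r)
    T′ = span (suc r)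
    i∉S : i ∉ S
    i∉S = proj₁ (before (entry i) (inject₁ r) (ℕ.≤-reflexive (Fin.toℕ-inject₁ r)))
    i∈T : i ∈ T′
    i∈T = proj₁ (after (entry i) (suc r) (ℕ.n<1+n _))
    k∉S : k ∉ S
    k∉S = proj₁ (before (entry k) (inject₁ r) (ℕ.≤-reflexive (trans (Fin.toℕ-inject₁ r) (cong toℕ e))))
    k∈T : k ∈ T′
    k∈T = proj₁ (after (entry k) (suc r) (ℕ.≤-reflexive (cong (suc ∘ toℕ) (sym e))))
    one-new : Subset.∣ T′ ∣ ℕ.< suc (suc Subset.∣ S ∣)
    one-new = ℕ.≤-reflexive (cong suc (trans (dimOk (suc r)) (cong suc (trans (sym (Fin.toℕ-inject₁ r)) (sym (dimOk (inject₁ r)))))))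
    S⊂T-k : S Subset.⊂ (T′ Subset.- k)
    S⊂T-k = (λ {x} x∈S → x∈p∧x≢y⇒x∈p-y (⊆F⇒⊆ (face (inject₁ r)) (face (suc r)) (chain r) x∈S) λ { refl → k∉S x∈S })
          , i , x∈p∧x≢y⇒x∈p-y i∈T i≢k , i∉S
    two-new : suc (suc Subset.∣ S ∣) ℕ.≤ Subset.∣ T′ ∣
    two-new = ℕ.≤-trans (s≤s (p⊂q⇒∣p∣<∣q∣ S⊂T-k)) (x∈p⇒∣p-x∣<∣p∣ k∈T)

  frameOf : Frame n
  frameOf = frame (injective⇒permutation (at ∘ entry) entry-injective) (sign ∘ entry) (corner zero)

  frameOf-describes : Describes Φ frameOf
  frameOf-describes j y = to , from
    where
    x₀ : Fin n → ℤ
    x₀ = corner zero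
    to : y ∈F face j → InCell frameOf (toℕ j) (lookup y)
    to y∈ i = below , λ r → let (i∉ , e) = before (entry i) j r in trans (proj₂ (y∈ i) i∉) e
      where
      lem : ∀ a → a - 1ℤ + 1ℤ ≡ a
      lem = solve-∀
      below : rk frameOf i ℕ.< toℕ j → (lookup y i ≡ x₀ i) ⊎ (lookup y i ≡ x₀ i + sgn (sign (entry i)) 1ℤ)
      below r with after (entry i) j r
      ... | i∈ , e with sign (entry i) | proj₁ (y∈ i) i∈
      ...   | false | inj₁ p = inj₁ (trans p e)
      ...   | false | inj₂ p = inj₂ (trans p (cong (_+ 1ℤ) e))
      ...   | true  | inj₁ p = inj₂ (trans p e)
      ...   | true  | inj₂ p = inj₁ (trans p (trans (cong (_+ 1ℤ) e) (lem (x₀ i))))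
    from : InCell frameOf (toℕ j) (lookup y) → y ∈F face j
    from c i with rk frameOf i ℕ.<? toℕ j
    ... | no ¬r with before (entry i) j (ℕ.≮⇒≥ ¬r)
    ...   | i∉ , e = (λ i∈ → contradiction i∈ i∉) , λ _ → trans (proj₂ (c i) (ℕ.≮⇒≥ ¬r)) (sym e)
    from c i | yes r with after (entry i) j r
    ...   | i∈ , e with sign (entry i) | proj₁ (c i) r
    ...     | false | inj₁ p = (λ _ → inj₁ (trans p (sym e))) , λ i∉ → contradiction i∈ i∉
    ...     | false | inj₂ p = (λ _ → inj₂ (trans p (cong (_+ 1ℤ) (sym e)))) , λ i∉ → contradiction i∈ i∉
    ...     | true  | inj₁ p = (λ _ → inj₂ (trans p (trans (lem (x₀ i)) (cong (_+ 1ℤ) (sym e))))) , λ i∉ → contradiction i∈ i∉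
      where
      lem : ∀ a → a ≡ a - 1ℤ + 1ℤ
      lem = solve-∀
    ...     | true  | inj₂ p = (λ _ → inj₁ (trans p (sym e))) , λ i∉ → contradiction i∈ i∉

-- Stabilisers of small index

open Equivalent using (images)

module FewOrbits {n} (5≤n : 5 ≤ n) (b : Fin n → Point n) {k} (orbits : HasFlagOrbits b k) (k<n : k < n) where

  private
    L : (Fin n → ℤ) → Set
    L = Lat b
    Φ : Fin k → Flag n
    Φ = proj₁ orbits
    cover : ∀ Ψ → Σ (Fin k) λ i → SameOrbit b (Φ i) Ψ
    cover = proj₁ (proj₂ orbits)

  open IsLattice (Lat-isLattice b) using (resp)
  open Lattice (Lat-isLattice b)

  _~_ : Frame n → Frame n → Set
  _~_ = Equivalent b

  ~-sym : ∀ {f g} → f ~ g → g ~ f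
  ~-sym (equivalent e) = equivalent λ z → proj₂ (e z) , proj₁ (e z)

  ~-trans : ∀ {f g h} → f ~ g → g ~ h → f ~ h
  ~-trans (equivalent e) (equivalent e′) = equivalent λ z → proj₁ (e′ z) ∘ proj₁ (e z) , proj₂ (e z) ∘ proj₂ (e′ z)

  orbit : Permutation′ n × Signs n → Fin k
  orbit (ρ , σ) = proj₁ (cover (centredFlag ρ σ))

  orbit~ : ∀ ρσ → FrameOf.frameOf (Φ (orbit ρσ)) ~ centred (proj₁ ρσ) (proj₂ ρσ)
  orbit~ (ρ , σ) = sameOrbit⇒equivalent b {Φ (orbit (ρ , σ))} {centredFlag ρ σ} (FrameOf.frameOf-describes (Φ (orbit (ρ , σ)))) (centredFlag-described ρ σ)
                     (proj₂ (cover (centredFlag ρ σ)))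

  distinct : ∀ {i j} → FrameOf.frameOf (Φ i) ~ FrameOf.frameOf (Φ j) → i ≡ j
  distinct {i} {j} e = proj₂ (proj₂ orbits) i j
    (equivalent⇒sameOrbit b {Φ i} {Φ j} (FrameOf.frameOf-describes (Φ i)) (FrameOf.frameOf-describes (Φ j)) e)

  -- Pairs are signed permutations, and this is equality of their cosets modulo K.
  Same : (x y : Permutation′ n × Signs n) → Set
  Same x y = centred (proj₁ x) (proj₂ x) ~ centred (proj₁ y) (proj₂ y)

  orbit≡⇒same : ∀ {x y} → orbit x ≡ orbit y → Same x y
  orbit≡⇒same {x} {y} e = ~-trans (~-sym (orbit~ x)) (subst (λ i → FrameOf.frameOf (Φ i) ~ _) (sym e) (orbit~ y))

  -- Comparing orbit labels decides it, as the listed representatives are pairwise inequivalent;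
  -- lattice membership is never decided.
  same? : ∀ x y → Dec (Same x y)
  same? x y with orbit x ≟ orbit y
  ... | yes e = yes (orbit≡⇒same e)
  ... | no ¬e = no λ s → ¬e (distinct (~-trans (orbit~ x) (~-trans s (~-sym (orbit~ y)))))

  collision : (g : Fin n → Permutation′ n × Signs n) → ∃₂ λ z z′ → z ≢ z′ × Same (g z) (g z′)
  collision g = let (z , z′ , z<z′ , e) = Fin.pigeonhole k<n (orbit ∘ g) in
    z , z′ , Fin.<⇒≢ z<z′ , orbit≡⇒same e

  swapping : Fin n → Fin n → Permutation′ n × Signs n
  swapping i j = Perm.transpose i j , ∅

  flipping : Fin n → Permutation′ n × Signs n
  flipping i = Perm.id , δ i

  Biimplied : (Fin n → ℤ) → (Fin n → ℤ) → Set
  Biimplied x y = (L x → L y) × (L y → L x)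

  biimplied-resp : ∀ {x x′ y y′} → x ≗ x′ → y ≗ y′ → Biimplied x y → Biimplied x′ y′
  biimplied-resp e e′ (p , q) = resp e′ ∘ p ∘ resp (sym ∘ e) , resp e ∘ q ∘ resp (sym ∘ e′)

  -- For an `R p q` saying that two vectors built from any `y` lie in the lattice together, the
  -- image under a transposition says this of the same vectors with permuted coordinates.
  -- Transpositions in one coset carry exactly the same vectors into the lattice, so they give the
  -- same image.
  fewImages : ∀ (R : Fin n → Fin n → Set) (α β : Fin n → Fin n → (Fin n → ℤ) → Fin n → ℤ) →
    (∀ i j p q → moved R (i , j) p q →
       ∀ y → Biimplied (α p q y ∘ transpose i j) (β p q y ∘ transpose i j)) →
    (∀ i j p q → (∀ y → Biimplied (α p q y ∘ transpose i j) (β p q y ∘ transpose i j)) →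
       moved R (i , j) p q) →
    FewImages R
  fewImages R α β elim intro t =
    let (z , z′ , z≢z′ , s) = collision (λ z → swapping (proj₁ (t z)) (proj₂ (t z))) in
    z , z′ , z≢z′ , transfer {t z} {t z′} s , transfer {t z′} {t z} (~-sym s)
    where
    transfer : ∀ {u v} → Same (swapping (proj₁ u) (proj₂ u)) (swapping (proj₁ v) (proj₂ v)) →
               ∀ p q → moved R u p q → moved R v p q
    transfer {i , j} {i′ , j′} (equivalent s) p q r = intro i′ j′ p q λ y →
      let (to , from) = elim i j p q r y in
        proj₁ (s (β p q y)) ∘ to ∘ proj₂ (s (α p q y))
      , proj₁ (s (α p q y)) ∘ from ∘ proj₂ (s (β p q y))

  -- Sign changes are involutions, so equality of the two cosets means sᵢsⱼ ∈ K; in coset form the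
  -- equivalence laws are immediate.
  FlipRelated : Fin n → Fin n → Set
  FlipRelated i j = Same (flipping i) (flipping j)

  flipRelated-isEquivalence : IsEquivalence FlipRelated
  flipRelated-isEquivalence = record
    { refl = equivalent λ _ → (λ p → p) , (λ p → p) ; sym = ~-sym ; trans = ~-trans }

  δ-transpose : ∀ (i j p : Fin n) y k → ((δ p · y) ∘ transpose i j) k ≡ (δ (transpose i j p) · (y ∘ transpose i j)) k
  δ-transpose i j p y k = cong (λ s → sgn s (y (transpose i j k)))
    (does-⇔ (mk⇔ (λ e → trans (sym (transpose-involutive i j k)) (cong (transpose i j) e))
                 (λ e → trans (cong (transpose i j) e) (transpose-involutive i j p)))
            (transpose i j k ≟ p) (k ≟ transpose i j p))

  flipRelated-fewImages : FewImages FlipRelated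
  flipRelated-fewImages = fewImages FlipRelated (λ p _ y → δ p · y) (λ _ q y → δ q · y)
    (λ i j p q r y → biimplied-resp (sym ∘ δ-transpose i j p y) (sym ∘ δ-transpose i j q y) (images r (y ∘ transpose i j)))
    (λ i j p q r → equivalent λ z → biimplied-resp
      (λ k → trans (δ-transpose i j p (z ∘ transpose i j) k) (cong (λ m → sgn (δ (transpose i j p) k) (z m)) (transpose-involutive i j k)))
      (λ k → trans (δ-transpose i j q (z ∘ transpose i j) k) (cong (λ m → sgn (δ (transpose i j q) k) (z m)) (transpose-involutive i j k)))
      (r (z ∘ transpose i j)))

  flipRelated-total : ∀ i j → FlipRelated i j
  flipRelated-total = let (_ , _ , z≢z′ , s) = collision flipping in
    NoProperPartition.total 5≤n FlipRelated (λ i j → same? (flipping i) (flipping j))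
      flipRelated-isEquivalence flipRelated-fewImages z≢z′ s

  evenSigns : ∀ i j → PreservedBySigns (δ i ⊻ δ j)
  evenSigns i j {x} l = resp (λ k → sgn-xor (δ i k) (δ j k) (x k))
    -- Testing on `δ j · x` makes the side with `δ j` equal to `x` itself.
    (proj₁ (images (flipRelated-total j i) (δ j · x)) (resp (λ k → sym (sgn-self (δ j k) (x k))) l))

  SwapRelated : Fin n → Fin n → Set
  SwapRelated i j = Same (Perm.id , ∅) (swapping i j)

  preserved⇒swapRelated : ∀ {i j} → PreservedBySwap i j → SwapRelated i j
  preserved⇒swapRelated {i} {j} p = equivalent λ z → p , resp (λ k → cong z (transpose-involutive i j k)) ∘ p

  swapRelated⇒preserved : ∀ {i j} → SwapRelated i j → PreservedBySwap i j
  swapRelated⇒preserved r {x} = proj₁ (images r x)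

  swapRelated-refl : ∀ i → SwapRelated i i
  swapRelated-refl i = preserved⇒swapRelated λ {x} → resp (λ k → cong x (sym (transpose-self i k)))

  swapRelated-isEquivalence : IsEquivalence SwapRelated
  swapRelated-isEquivalence = record
    { refl  = λ {i} → swapRelated-refl i
    ; sym   = λ {i} {j} r → preserved⇒swapRelated λ {x} → resp (λ k → cong x (transpose-comm i j k)) ∘ proj₁ (images r x)
    ; trans = λ {i} {j} {k} → swap-trans i j k
    }
    where
    swap-trans : ∀ i j k → SwapRelated i j → SwapRelated j k → SwapRelated i k
    swap-trans i j k r s with k ≟ i | k ≟ j
    ... | yes refl | _ = swapRelated-refl i
    ... | no _ | yes refl = r
    -- With `k` different from both, (i k) is the conjugate of (j k) by (i j).
    ... | no k≢i | no k≢j = preserved⇒swapRelated λ {x} →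
      resp (λ m → cong x (sym (conj m))) ∘ proj₁ (images r _) ∘ proj₁ (images s _) ∘ proj₁ (images r x)
      where
      conj : ∀ m → transpose i k m ≡ transpose i j (transpose j k (transpose i j m))
      conj m = begin
        transpose i k m
          ≡⟨ cong₂ (λ u v → transpose u v m) (transpose-second i j) (transpose-other k≢i k≢j) ⟨
        transpose (transpose i j j) (transpose i j k) m
          ≡⟨ cong (transpose (transpose i j j) (transpose i j k)) (transpose-involutive i j m) ⟨
        transpose (transpose i j j) (transpose i j k) (transpose i j (transpose i j m))
          ≡⟨ transpose-conj (transpose i j) (transpose-injective i j) j k (transpose i j m) ⟩
        transpose i j (transpose j k (transpose i j m)) ∎
        where open ≡-Reasoning

  swapRelated-fewImages : FewImages SwapRelated
  swapRelated-fewImages = fewImages SwapRelated (λ _ _ y → y) (λ p q y → y ∘ transpose p q)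
    (λ i j p q r y → biimplied-resp (λ _ → refl) (λ k → cong y (conj i j p q k)) (images r (y ∘ transpose i j)))
    (λ i j p q r → equivalent λ z → biimplied-resp
      (λ k → cong z (transpose-involutive i j k))
      (λ k → trans (cong (z ∘ transpose i j) (sym (conj i j p q k))) (cong z (transpose-involutive i j _)))
      (r (z ∘ transpose i j)))
    where
    conj : ∀ i j p q k → transpose i j (transpose (transpose i j p) (transpose i j q) k) ≡ transpose p q (transpose i j k)
    conj i j p q k = trans (sym (transpose-conj (transpose i j) (transpose-injective i j) (transpose i j p) (transpose i j q) k))
      (cong₂ (λ u v → transpose u v (transpose i j k)) (transpose-involutive i j p) (transpose-involutive i j q))

  -- Two transpositions through `a` in one coset differ by an element of K. If one of them is the
  -- degenerate (a a), that element is the other transposition; otherwise it is a 3-cycle.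
  collision⇒swap : ∀ {a z z′} → z ≢ z′ → Same (swapping a z) (swapping a z′) → Dec (a ≡ z) → Dec (a ≡ z′) →
    ∃₂ λ i j → i ≢ j × SwapRelated i j
  collision⇒swap {a} {z} {z′} z≢z′ s (yes refl) _ = a , z′ , z≢z′ , ~-trans (swapRelated-refl a) s
  collision⇒swap {a} {z} {z′} z≢z′ s (no _) (yes refl) = a , z , z≢z′ ∘ sym , ~-trans (swapRelated-refl a) (~-sym s)
  -- Only three points have to be avoided, so `a` is passed twice.
  collision⇒swap {a} {z} {z′} z≢z′ s (no a≢z) (no a≢z′) = a , z , a≢z , preserved⇒swapRelated (swap (∃-avoiding₄ 5≤n a z z′ a))
    where
    swap : (∃ λ l → l ≢ a × l ≢ z × l ≢ z′ × l ≢ a) → PreservedBySwap a z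
    swap (l , l≢a , l≢z , l≢z′ , _) = three-cycle⇒swap a≢z a≢z′ z≢z′ l≢a l≢z l≢z′ (evenSigns z′ l)
      -- On `x ∘ transpose a z` the first swap cancels and the second completes the 3-cycle.
      λ {x} lx → proj₁ (images s (x ∘ transpose a z)) (resp (λ k → cong x (sym (transpose-involutive a z k))) lx)

  some-swap : Fin n → ∃₂ λ i j → i ≢ j × SwapRelated i j
  some-swap a = let (z , z′ , z≢z′ , s) = collision (swapping a) in collision⇒swap z≢z′ s (a ≟ z) (a ≟ z′)

  swaps : ∀ i j → PreservedBySwap i j
  swaps i j = let (_ , _ , a≢c , r) = some-swap i in swapRelated⇒preserved
    (NoProperPartition.total 5≤n SwapRelated (λ i j → same? (Perm.id , ∅) (swapping i j))
      swapRelated-isEquivalence swapRelated-fewImages a≢c r i j)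

  -- Sign parity and the number of orbits

  outerSigns : Frame n → Signs n
  outerSigns f k = signs f (rank f ⟨$⟩ˡ k)

  -- Since every permutation preserves the lattice, the rank of a frame no longer matters; only its
  -- signs, reindexed by rank, remain.
  transform-outer : ∀ f z → Biimplied (transform f z) (outerSigns f · z)
  transform-outer f z = to , from
    where
    to : L (transform f z) → L (outerSigns f · z)
    to l = resp (λ k → cong (λ m → sgn (signs f (rank f ⟨$⟩ˡ k)) (z m)) (inverseʳ (rank f)))
             (preservedByPerms swaps (Perm.flip (rank f)) l)
    from : L (outerSigns f · z) → L (transform f z)
    from l = resp (λ i → cong (λ m → sgn (signs f m) (z (rank f ⟨$⟩ʳ i))) (inverseˡ (rank f)))
             (preservedByPerms swaps (rank f) l)

  ⊻-preserved⇒~ : ∀ {f g} → PreservedBySigns (outerSigns f ⊻ outerSigns g) → f ~ g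
  ⊻-preserved⇒~ {f} {g} p = equivalent λ z →
      proj₂ (transform-outer g z) ∘ resp (λ k → cancel (σ k) (τ k) (z k)) ∘ p ∘ proj₁ (transform-outer f z)
    , proj₂ (transform-outer f z) ∘ resp (λ k → cancel′ (σ k) (τ k) (z k)) ∘ p ∘ proj₁ (transform-outer g z)
    where
    σ = outerSigns f
    τ = outerSigns g
    cancel′ : ∀ s t x → sgn (s xor t) (sgn t x) ≡ sgn s x
    cancel′ s t x = trans (sym (sgn-xor s t (sgn t x))) (cong (sgn s) (sgn-self t x))
    cancel : ∀ s t x → sgn (s xor t) (sgn s x) ≡ sgn t x
    cancel s t x = trans (cong (λ u → sgn u (sgn s x)) (Bool.xor-comm s t)) (cancel′ t s x)

  module _ (o : Fin n) where

    -- Modulo even sign changes every sign change is trivial or `δ o`. Each further flip is paired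
    -- with the one at `o`, which switches the alternative.
    parity : ∀ τ → PreservedBySigns τ ⊎ PreservedBySigns (δ o ⊻ τ)
    parity = signs-induction _
      (λ { e (inj₁ p) → inj₁ (preservedBySigns-resp e p)
         ; e (inj₂ p) → inj₂ (preservedBySigns-resp (λ k → cong (δ o k xor_) (e k)) p) })
      (inj₁ λ l → l)
      λ { i {σ} (inj₁ p) → inj₂ (preservedBySigns-resp (λ k → Bool.xor-assoc (δ o k) (δ i k) (σ k))
                               (preservedBySigns-⊻ {δ o ⊻ δ i} {σ} (evenSigns o i) p))
        ; i {σ} (inj₂ p) → inj₁ (preservedBySigns-resp (λ k → merge (δ i k) (δ o k) (σ k))
                               (preservedBySigns-⊻ {δ i ⊻ δ o} {δ o ⊻ σ} (evenSigns i o) p)) }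
      where
      merge : ∀ s t u → (s xor t) xor (t xor u) ≡ s xor u
      merge s false u = cong (_xor u) (Bool.xor-identityʳ s)
      merge false true false = refl
      merge false true true  = refl
      merge true  true u = refl

    outer : Fin k → Signs n
    outer i = outerSigns (FrameOf.frameOf (Φ i))

    even-even : ∀ {i j} → i ≢ j → PreservedBySigns (outer i) → PreservedBySigns (outer j) → ⊥
    even-even {i} {j} i≢j p q = i≢j (distinct (⊻-preserved⇒~ (preservedBySigns-⊻ {outer i} {outer j} p q)))

    odd-odd : ∀ {i j} → i ≢ j → PreservedBySigns (δ o ⊻ outer i) → PreservedBySigns (δ o ⊻ outer j) → ⊥
    odd-odd {i} {j} i≢j p q = i≢j (distinct (⊻-preserved⇒~
      (preservedBySigns-resp (λ k → merge (δ o k) (outer i k) (outer j k))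
        (preservedBySigns-⊻ {δ o ⊻ outer i} {δ o ⊻ outer j} p q))))
      where
      merge : ∀ s t u → (s xor t) xor (s xor u) ≡ t xor u
      merge false t u = refl
      merge true false u = Bool.not-involutive u
      merge true true u = refl

    -- Two of three orbits share a parity; their sign vectors then differ by one preserving the
    -- lattice, so the representatives are equivalent.
    no-three-orbits : ∀ {i j l} → i ≢ j → i ≢ l → j ≢ l → ⊥
    no-three-orbits {i} {j} {l} i≢j i≢l j≢l = go (parity (outer i)) (parity (outer j)) (parity (outer l))
      where
      go : PreservedBySigns (outer i) ⊎ PreservedBySigns (δ o ⊻ outer i) →
           PreservedBySigns (outer j) ⊎ PreservedBySigns (δ o ⊻ outer j) →
           PreservedBySigns (outer l) ⊎ PreservedBySigns (δ o ⊻ outer l) → ⊥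
      go (inj₁ p) (inj₁ q) _        = even-even i≢j p q
      go (inj₂ p) (inj₂ q) _        = odd-odd i≢j p q
      go (inj₁ p) (inj₂ _) (inj₁ r) = even-even i≢l p r
      go (inj₂ p) (inj₁ _) (inj₂ r) = odd-odd i≢l p r
      go (inj₂ _) (inj₁ q) (inj₁ r) = even-even j≢l q r
      go (inj₁ _) (inj₂ q) (inj₂ r) = odd-odd j≢l q r

theorem3 : ∀ (n : ℕ) → 5 ≤ n → (b : Fin n → Point n) → LinIndep b →
    ∀ (k : ℕ) → HasFlagOrbits b k → ¬ (2 < k × k < n)
theorem3 n 5≤n@(s≤s _) b _ k orbits (s≤s (s≤s (s≤s _)) , k<n) =
  FewOrbits.no-three-orbits 5≤n b orbits k<n zero {0F} {1F} {2F} (λ ()) (λ ()) (λ ())
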